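{- For each $x$ let $d^*=d^*(x)$ be a prime difference champion for primes $\le x$. Then $d^*(x)\to\infty$ as $x\to\infty$, and the number of distinct prime factors of $d^*(x)$ also tends to infinity as $x\to\infty$.
   Context: For $x\ge 2$ and a positive integer $d$, let $G(x,d)$ be the number of pairs of primes $(p,p')$ with $p,p'\le x$ and $p'-p=d$. A prime difference champion for $x$ is any positive integer $d$ at which $G(x,d)$ attains its maximum over positive integers $d$. This result is unconditional. -}

module Defs where

open import Data.Nat using (ℕ; _+_; _≤_; _<_; _≤?_)
open import Data.Nat.Primality using (Prime; prime?)
open import Data.Nat.Divisibility using (_∣_; _∣?_)
open import Data.List using (List; length; filter; upTo)
open import Data.Product using (_×_)
open import Relation.Nullary.Decidable using (_×-dec_)

-- G x d = #{ (p , p') : p, p' prime, p, p' ≤ x, p' - p = d }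
-- (pairs are determined by p, with p' = p + d; p ranges over 0..x)
G : ℕ → ℕ → ℕ
G x d = length (filter (λ p → prime? p ×-dec (prime? (p + d) ×-dec ((p + d) ≤? x))) (upTo (ℕ.suc x)))

Champion : ℕ → ℕ → Set
Champion x d = (0 < d) × (∀ e → 0 < e → G x e ≤ G x d)

ω : ℕ → ℕ
ω d = length (filter (λ p → prime? p ×-dec (p ∣? d)) (upTo (ℕ.suc d)))

{-# OPTIONS --safe #-}

-- Averaging against a modulus beats every difference with few prime factors.
--
-- Lower bound. Let P be the product of the primes up to 2^t. The primes beyond 2^t lie in
-- φ(P) classes modulo P, so by Cauchy–Schwarz at least about π(x)²/φ(P) pairs of them are
-- congruent modulo P. Their differences are among the x/P multiples of P up to x, hence
-- some G(x,e) is at least about (P/φ(P)) π(x)²/(2x), where P/φ(P) ≥ t/2 is as large as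
-- we like and π(x) ≫ x/log x by Chebyshev.
--
-- Upper bound. If ω(d) < M then G(x,d) ≤ C_M x/log²x, by Selberg's sieve in dual form: for
-- p ∤ 2d the function 2 - p·1[p ∣ n(n+d)] has mean zero modulo p, so its products over
-- distinct squarefree moduli are nearly orthogonal on n ≤ x, while every one of them is
-- known exactly at a sifted n. Bessel's inequality then bounds the number of sifted n by
-- x/V, V = Σ_{k ≤ z} ∏_{p ∣ k} 2/(p-2) over squarefree k prime to 2d, and V ≫_M log²z.
--
-- Logarithms are replaced by an exponent s with 2^(30s) ≤ x < 2^(30(s+1)), and all rational
-- weights by integers, after multiplication by ∏(p-1) or ∏(p-2).
module Submission where

open import Defs
open import Level using (0ℓ)
open import Algebra.Bundles using (CommutativeSemiring)
open import Data.Bool.Base using (true; false; if_then_else_)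
open import Data.Fin.Base using (toℕ)
open import Data.Fin.Properties using (toℕ<n)
open import Data.Integer.Base as ℤ using (ℤ; ∣_∣) renaming (+_ to pos; _+_ to _+′_; _*_ to _*′_; _-_ to _-′_; -_ to -′_)
import Data.Integer.Properties as ℤ
import Data.Integer.Tactic.RingSolver as ℤ-Solver
open import Data.List.Base using (List; []; _∷_; length; filter; applyUpTo; upTo; downFrom; map)
open import Data.List.Membership.Propositional using (_∈_; find)
open import Data.List.Membership.Propositional.Properties using (∈-filter⁺; ∈-filter⁻; ∈-downFrom⁺; ∈-downFrom⁻)
open import Data.List.Properties using (length-filter; length-upTo)
open import Data.List.Relation.Unary.All as All using (All; []; _∷_)
open import Data.List.Relation.Unary.All.Properties using (all-filter; filter⁺; ¬Any⇒All¬)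
open import Data.List.Relation.Unary.AllPairs using ([]; _∷_)
open import Data.List.Relation.Unary.Any using (here; there; any?)
open import Data.List.Relation.Unary.Unique.Propositional using (Unique)
import Data.List.Relation.Unary.Unique.Propositional.Properties as Unique
open import Data.Nat.Base
open import Data.Nat.Coprimality using (Coprime; coprime-Bézout; coprime-divisor) renaming (sym to coprime-sym)
open import Data.Nat.DivMod
open import Data.Nat.Divisibility
open import Data.Nat.GCD using (module Bézout)
open import Data.Nat.Induction using (<-rec)
open import Data.Nat.ListAction using (product)
open import Data.Nat.Primality
open import Data.Nat.Primality.Factorisation using (PrimeFactorisation; factorise; factorisationHasAllPrimeFactors)
open import Data.Nat.Properties
open import Data.Nat.Tactic.RingSolver using (solve-∀)
open import Data.Product.Base using (_×_; _,_; proj₁; proj₂; ∃-syntax)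
open import Data.Sum.Base using (_⊎_; inj₁; inj₂; [_,_]′)
open import Function.Base using (_∘_; id)
open import Relation.Binary.PropositionalEquality using (_≡_; _≢_; refl; sym; trans; cong; cong₂; subst; subst₂)
open import Relation.Nullary.Decidable using (Dec; yes; no; does; ¬?; _×-dec_; dec-true; dec-false; from-yes)
open import Relation.Nullary.Negation using (¬_; contradiction)
open import Relation.Unary using (Decidable)

-- Finite sums

-- Both bounds have order x/log²x, and both lose constant factors. The loss is harmless because the
-- gain P/φ(P) is unbounded in t. The parameters are therefore chosen in a fixed order: M determines
-- the sieve constant, which determines t and with it P, and only then does x grow, so that every
-- term depending on P alone becomes negligible. A champion with ω(d) < M would confine t to c²(1 +
-- 16·4^(M+1)). The sieve needs a lower bound for V of order log²z. It comes from squaring the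
-- Mertens sum of 1/φ(k). The primes dividing 2d must be left out of that sum, at a cost of a factor
-- 2 each, and this is where ω(d) enters. Orthogonality fails slightly because x is not a multiple
-- of the periods. The resulting error is a fixed power of 2^s, which x ≥ 2^(30s) absorbs, while log
-- x remains comparable with s. The growth of d itself follows from ω(d) ≤ d + 1.

period-* : ∀ {A : Set} (f : ℕ → A) q → (∀ n → f (n + q) ≡ f n) → ∀ k n → f (n + k * q) ≡ f n
period-* f q period zero    n = cong f (+-identityʳ n)
period-* f q period (suc k) n =
  trans (cong f (trans (cong (n +_) (+-comm q (k * q))) (sym (+-assoc n (k * q) q))))
        (trans (period (n + k * q)) (period-* f q period k n))

module Sum (R : CommutativeSemiring 0ℓ 0ℓ) where
  private module S = CommutativeSemiring R
  open S using (Carrier; _≈_; 0#) renaming (_+_ to _⊕_; _*_ to _⊗_)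
  open import Algebra.Properties.Semiring.Sum S.semiring
  open import Relation.Binary.Reasoning.Setoid S.setoid

  opaque
    ∑ : ℕ → (ℕ → Carrier) → Carrier
    ∑ n f = sum {n} (f ∘ toℕ)

    ∑-suc : ∀ n f → ∑ (suc n) f ≈ f 0 ⊕ ∑ n (f ∘ suc)
    ∑-suc n f = S.refl

    ∑-cong< : ∀ n {f g} → (∀ i → i < n → f i ≈ g i) → ∑ n f ≈ ∑ n g
    ∑-cong< n eq = sum-cong-≋ {n} λ i → eq (toℕ i) (toℕ<n i)

    ∑-cong : ∀ n {f g} → (∀ i → f i ≈ g i) → ∑ n f ≈ ∑ n g
    ∑-cong n eq = ∑-cong< n λ i _ → eq i

    ∑-+ : ∀ n f g → ∑ n (λ i → f i ⊕ g i) ≈ ∑ n f ⊕ ∑ n g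
    ∑-+ n f g = ∑-distrib-+ {n} (f ∘ toℕ) (g ∘ toℕ)

    ∑-*ˡ : ∀ n c f → ∑ n (λ i → c ⊗ f i) ≈ c ⊗ ∑ n f
    ∑-*ˡ n c f = S.sym (*-distribˡ-sum {n} c (f ∘ toℕ))

    ∑-*ʳ : ∀ n c f → ∑ n (λ i → f i ⊗ c) ≈ ∑ n f ⊗ c
    ∑-*ʳ n c f = S.sym (*-distribʳ-sum {n} c (f ∘ toℕ))

    ∑-swap : ∀ m n (f : ℕ → ℕ → Carrier) → ∑ m (λ i → ∑ n (f i)) ≈ ∑ n (λ j → ∑ m (λ i → f i j))
    ∑-swap m n f = ∑-comm {m} {n} (λ i j → f (toℕ i) (toℕ j))

    ∑-zero : ∀ n {f} → (∀ i → i < n → f i ≈ 0#) → ∑ n f ≈ 0#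
    ∑-zero n eq = S.trans (∑-cong< n eq) (sum-replicate-zero n)

    ∑-split : ∀ m n f → ∑ (m + n) f ≈ ∑ m f ⊕ ∑ n (λ i → f (m + i))
    ∑-split zero    n f = S.sym (S.+-identityˡ _)
    ∑-split (suc m) n f = S.trans (S.+-congˡ (∑-split m n (f ∘ suc))) (S.sym (S.+-assoc _ _ _))

    ∑-last : ∀ n f → ∑ (suc n) f ≈ ∑ n f ⊕ f n
    ∑-last zero    f = S.trans (S.+-identityʳ _) (S.sym (S.+-identityˡ _))
    ∑-last (suc n) f = S.trans (S.+-congˡ (∑-last n (f ∘ suc))) (S.sym (S.+-assoc _ _ _))

    ∑-blocks : ∀ p q f → ∑ (p * q) f ≈ ∑ p (λ i → ∑ q (λ r → f (r + i * q)))
    ∑-blocks zero    q f = S.refl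
    ∑-blocks (suc p) q f = begin
      ∑ (q + p * q) f
        ≈⟨ ∑-split q (p * q) f ⟩
      ∑ q f ⊕ ∑ (p * q) (λ j → f (q + j))
        ≈⟨ S.+-cong (∑-cong q λ r → S.reflexive (cong f (sym (+-identityʳ r))))
                  (S.trans (∑-blocks p q (λ j → f (q + j)))
                           (∑-cong p λ i → ∑-cong q λ r → S.reflexive (cong f (shuffle r (i * q))))) ⟩
      ∑ (suc p) (λ i → ∑ q (λ r → f (r + i * q))) ∎
      where
      shuffle : ∀ r k → q + (r + k) ≡ r + (q + k)
      shuffle r k = trans (sym (+-assoc q r k))
        (trans (cong (_+ k) (+-comm q r)) (+-assoc r q k))

  -- Write n = r + i·q. By periodicity `f` sees only r, and `g` has the same sum along every
  -- progression. For a prime p not dividing q, the hypothesis on `g` is verified by solving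
  -- congruences modulo p.
  ∑-crt : ∀ p q (f g : ℕ → Carrier) t → (∀ n → f (n + q) ≡ f n) → (∀ r → ∑ p (λ i → g (r + i * q)) ≈ t) →
    ∑ (p * q) (λ n → f n ⊗ g n) ≈ ∑ q f ⊗ t
  ∑-crt p q f g t period mean = begin
    ∑ (p * q) (λ n → f n ⊗ g n)
      ≈⟨ ∑-blocks p q _ ⟩
    ∑ p (λ i → ∑ q (λ r → f (r + i * q) ⊗ g (r + i * q)))
      ≈⟨ ∑-cong p (λ i → ∑-cong q λ r → S.*-congʳ (S.reflexive (period-* f q period i r))) ⟩
    ∑ p (λ i → ∑ q (λ r → f r ⊗ g (r + i * q)))
      ≈⟨ ∑-swap p q _ ⟩
    ∑ q (λ r → ∑ p (λ i → f r ⊗ g (r + i * q)))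
      ≈⟨ ∑-cong q (λ r → S.trans (∑-*ˡ p (f r) _) (S.*-congˡ (mean r))) ⟩
    ∑ q (λ r → f r ⊗ t)
      ≈⟨ ∑-*ʳ q t f ⟩
    ∑ q f ⊗ t ∎

open Sum +-*-commutativeSemiring

⟦_⟧ : {P : Set} → Dec P → ℕ
⟦ P? ⟧ = if does P? then 1 else 0

opaque
  unfolding ∑

  ∑-mono< : ∀ n {f g} → (∀ i → i < n → f i ≤ g i) → ∑ n f ≤ ∑ n g
  ∑-mono< zero    le = z≤n
  ∑-mono< (suc n) le = +-mono-≤ (le 0 z<s) (∑-mono< n λ i i<n → le (suc i) (s<s i<n))

  ∑-const : ∀ n c → ∑ n (λ _ → c) ≡ n * c
  ∑-const zero    c = refl
  ∑-const (suc n) c = cong (c +_) (∑-const n c)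

  length-filter-applyUpTo : ∀ {P : ℕ → Set} (P? : Decidable P) f n →
    length (filter P? (applyUpTo f n)) ≡ ∑ n (λ i → ⟦ P? (f i) ⟧)
  length-filter-applyUpTo P? f zero    = refl
  length-filter-applyUpTo P? f (suc n) with does (P? (f 0))
  ... | true  = cong suc (length-filter-applyUpTo P? (f ∘ suc) n)
  ... | false = length-filter-applyUpTo P? (f ∘ suc) n

∑-mono : ∀ n {f g} → (∀ i → f i ≤ g i) → ∑ n f ≤ ∑ n g
∑-mono n le = ∑-mono< n λ i _ → le i

∑-prefix : ∀ {m n} f → m ≤ n → ∑ m f ≤ ∑ n f
∑-prefix {m} f m≤n with k , refl ← m≤n⇒∃[o]m+o≡n m≤n =
  ≤-trans (m≤m+n _ _) (≤-reflexive (sym (∑-split m k f)))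

∑-trim : ∀ m n {f} → (∀ i → m ≤ i → f i ≡ 0) → ∑ n f ≤ ∑ m f
∑-trim m n {f} vanish = begin
  ∑ n f                          ≤⟨ ∑-prefix f (m≤n+m n m) ⟩
  ∑ (m + n) f                    ≡⟨ ∑-split m n f ⟩
  ∑ m f + ∑ n (λ i → f (m + i))  ≡⟨ cong (∑ m f +_) (∑-zero n λ i _ → vanish (m + i) (m≤m+n m i)) ⟩
  ∑ m f + 0                      ≡⟨ +-identityʳ _ ⟩
  ∑ m f                          ∎
  where open ≤-Reasoning

⟦⟧-yes : ∀ {P : Set} (P? : Dec P) → P → ⟦ P? ⟧ ≡ 1
⟦⟧-yes P? p rewrite dec-true P? p = refl

⟦⟧-no : ∀ {P : Set} (P? : Dec P) → ¬ P → ⟦ P? ⟧ ≡ 0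
⟦⟧-no P? ¬p rewrite dec-false P? ¬p = refl

⟦⟧≤1 : ∀ {P : Set} (P? : Dec P) → ⟦ P? ⟧ ≤ 1
⟦⟧≤1 (yes _) = ≤-refl
⟦⟧≤1 (no _)  = z≤n

⟦⟧-mono : ∀ {P Q : Set} (P? : Dec P) (Q? : Dec Q) → (P → Q) → ⟦ P? ⟧ ≤ ⟦ Q? ⟧
⟦⟧-mono (yes p) Q? P⇒Q = ≤-reflexive (sym (⟦⟧-yes Q? (P⇒Q p)))
⟦⟧-mono (no _)  Q? P⇒Q = z≤n

⟦⟧-¬ : ∀ {P : Set} (P? : Dec P) → ⟦ ¬? P? ⟧ + ⟦ P? ⟧ ≡ 1
⟦⟧-¬ (yes _) = refl
⟦⟧-¬ (no _)  = refl

open ≤-Reasoning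

-- Mertens' lower bound

-- Division with the junk value n ÷ 0 = 0.
infixl 7 _÷_
_÷_ : ℕ → ℕ → ℕ
n ÷ zero  = 0
n ÷ suc m = n / suc m

0÷ : ∀ m → 0 ÷ m ≡ 0
0÷ zero    = refl
0÷ (suc m) = 0/n≡0 (suc m)

÷-small : ∀ {n m} → n < m → n ÷ m ≡ 0
÷-small {m = suc m} n<m = m<n⇒m/n≡0 n<m

÷-monoˡ : ∀ m {k n} → k ≤ n → k ÷ m ≤ n ÷ m
÷-monoˡ zero    k≤n = z≤n
÷-monoˡ (suc m) k≤n = /-monoˡ-≤ (suc m) k≤n

*÷≤ : ∀ n m → m * (n ÷ m) ≤ n
*÷≤ n zero    = z≤n
*÷≤ n (suc m) = ≤-trans (≤-reflexive (*-comm (suc m) (n / suc m))) (m/n*n≤m n (suc m))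

÷≤ : ∀ n m → n ÷ m ≤ n
÷≤ n zero    = z≤n
÷≤ n (suc m) = m/n≤m n (suc m)

*≤⇒≤÷ : ∀ m .{{_ : NonZero m}} k {n} → m * k ≤ n → k ≤ n ÷ m
*≤⇒≤÷ (suc m) k {n} le = begin
  k                  ≡⟨ m*n/n≡m k (suc m) ⟨
  k * suc m / suc m  ≤⟨ /-monoˡ-≤ (suc m) (≤-trans (≤-reflexive (*-comm k (suc m))) le) ⟩
  n / suc m          ∎

÷-* : ∀ n q m → n ÷ (m * q) ≡ n ÷ q ÷ m
÷-* n zero    m       rewrite *-zeroʳ m | 0÷ m = refl
÷-* n (suc q) zero    = refl
÷-* n (suc q) (suc m) = trans (/-congʳ {m = n} (*-comm (suc m) (suc q))) (sym (m/n/o≡m/[n*o] n (suc q) (suc m)))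

sift : List ℕ → ℕ → ℕ
sift []       m = 1
sift (q ∷ qs) m = ⟦ ¬? (q ∣? m) ⟧ * sift qs m

sift≤1 : ∀ qs m → sift qs m ≤ 1
sift≤1 []       m = ≤-refl
sift≤1 (q ∷ qs) m = *-mono-≤ (⟦⟧≤1 (¬? (q ∣? m))) (sift≤1 qs m)

sift-∣ : ∀ qs {m n} → m ∣ n → sift qs n ≤ sift qs m
sift-∣ []       m∣n = ≤-refl
sift-∣ (q ∷ qs) {m} {n} m∣n =
  *-mono-≤ (⟦⟧-mono (¬? (q ∣? n)) (¬? (q ∣? m)) (λ q∤n q∣m → q∤n (∣-trans q∣m m∣n))) (sift-∣ qs m∣n)

sift-zero : ∀ {qs q m} → q ∈ qs → q ∣ m → sift qs m ≡ 0
sift-zero {q ∷ qs} {m = m} (here refl) q∣m = cong (_* sift qs m) (⟦⟧-no (¬? (q ∣? m)) (λ q∤m → q∤m q∣m))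
sift-zero {q ∷ qs} {m = m} (there q∈) q∣m = trans (cong (⟦ ¬? (q ∣? m) ⟧ *_) (sift-zero q∈ q∣m)) (*-zeroʳ ⟦ ¬? (q ∣? m) ⟧)

∑-multiples : ∀ q .{{_ : NonZero q}} n (f : ℕ → ℕ) → ∑ (n * q) (λ m → ⟦ q ∣? m ⟧ * f m) ≡ ∑ n (λ i → f (i * q))
∑-multiples (suc q) n f = trans (∑-blocks n (suc q) _) (∑-cong n block)
  where
  hit : ∀ i → ⟦ suc q ∣? i * suc q ⟧ * f (i * suc q) ≡ f (i * suc q)
  hit i = trans (cong (_* f (i * suc q)) (⟦⟧-yes (suc q ∣? i * suc q) (n∣m*n i))) (+-identityʳ _)
  miss : ∀ i r → r < q → ⟦ suc q ∣? suc r + i * suc q ⟧ * f (suc r + i * suc q) ≡ 0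
  miss i r r<q = cong (_* f (suc r + i * suc q)) (⟦⟧-no (suc q ∣? suc r + i * suc q) λ d →
    >⇒∤ (s≤s r<q) (∣m+n∣m⇒∣n (subst (suc q ∣_) (+-comm (suc r) (i * suc q)) d) (n∣m*n i)))
  block : ∀ i → ∑ (suc q) (λ r → ⟦ suc q ∣? r + i * suc q ⟧ * f (r + i * suc q)) ≡ f (i * suc q)
  block i = trans (∑-suc q _) (trans (cong₂ _+_ (hit i) (∑-zero q (miss i))) (+-identityʳ _))

-- A floor version of y times the sum of 1/m over the m ≤ y with no divisor in `qs`. Floors compose
-- exactly (`÷-*`), so the recursion over primes stays in the integers. The term m = 0 vanishes
-- because `y ÷ 0` is 0.
divisorSum : List ℕ → ℕ → ℕ
divisorSum qs y = ∑ (suc y) (λ m → sift qs m * (y ÷ m))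

-- Split by divisibility of m by q. A multiple m = i·q contributes ⌊⌊y/q⌋/i⌋, and i survives `qs`
-- whenever i·q does.
divisorSum-step : ∀ q .{{_ : NonZero q}} qs y →
  divisorSum qs y ≤ divisorSum (q ∷ qs) y + divisorSum qs (y ÷ q)
divisorSum-step q qs y = begin
  divisorSum qs y
    -- Whole blocks of length q contain exactly one multiple of q each; the excess range is trimmed
    -- off again below.
    ≤⟨ ∑-prefix F (m≤m*n (suc y) q) ⟩
  ∑ (suc y * q) F
    ≡⟨ ∑-cong (suc y * q) (λ m → begin-equality
         F m                                            ≡⟨ +-identityʳ (F m) ⟨
         1 * F m                                        ≡⟨ cong (_* F m) (⟦⟧-¬ (q ∣? m)) ⟨
         (⟦ ¬? (q ∣? m) ⟧ + ⟦ q ∣? m ⟧) * F m           ≡⟨ *-distribʳ-+ (F m) ⟦ ¬? (q ∣? m) ⟧ ⟦ q ∣? m ⟧ ⟩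
         ⟦ ¬? (q ∣? m) ⟧ * F m + ⟦ q ∣? m ⟧ * F m
           ≡⟨ cong (_+ ⟦ q ∣? m ⟧ * F m) (*-assoc ⟦ ¬? (q ∣? m) ⟧ (sift qs m) (y ÷ m)) ⟨
         F′ m + ⟦ q ∣? m ⟧ * F m                        ∎) ⟩
  ∑ (suc y * q) (λ m → F′ m + ⟦ q ∣? m ⟧ * F m)
    ≡⟨ ∑-+ (suc y * q) F′ _ ⟩
  ∑ (suc y * q) F′ + ∑ (suc y * q) (λ m → ⟦ q ∣? m ⟧ * F m)
    ≤⟨ +-mono-≤ (∑-trim (suc y) (suc y * q) (λ i y<i → vanish (q ∷ qs) y i y<i))
                (≤-reflexive (∑-multiples q (suc y) F)) ⟩
  divisorSum (q ∷ qs) y + ∑ (suc y) (λ i → F (i * q))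
    ≤⟨ +-monoʳ-≤ (divisorSum (q ∷ qs) y) (∑-mono (suc y) λ i →
         *-mono-≤ (sift-∣ qs (m∣m*n q)) (≤-reflexive (÷-* y q i))) ⟩
  divisorSum (q ∷ qs) y + ∑ (suc y) (λ i → sift qs i * (y ÷ q ÷ i))
    ≤⟨ +-monoʳ-≤ (divisorSum (q ∷ qs) y) (∑-trim (suc (y ÷ q)) (suc y) (vanish qs (y ÷ q))) ⟩
  divisorSum (q ∷ qs) y + divisorSum qs (y ÷ q) ∎
  where
  F F′ : ℕ → ℕ
  F m  = sift qs m * (y ÷ m)
  F′ m = sift (q ∷ qs) m * (y ÷ m)
  vanish : ∀ qs y i → y < i → sift qs i * (y ÷ i) ≡ 0
  vanish qs y i y<i = trans (cong (sift qs i *_) (÷-small y<i)) (*-zeroʳ (sift qs i))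

divisorSum-zero : ∀ qs → divisorSum qs 0 ≡ 0
divisorSum-zero qs = trans (∑-last 0 _) (trans (cong₂ _+_ (∑-zero 0 λ _ ()) (*-zeroʳ (sift qs 0))) refl)

-- The terms with m ≤ y at least double, and each m with y < m ≤ 2y contributes 1. Iteration from y
-- = 1 gives the logarithmic growth of the harmonic sum.
divisorSum-double : ∀ y → 2 * divisorSum [] y + y ≤ divisorSum [] (2 * y)
divisorSum-double y = begin
  2 * divisorSum [] y + y
    ≡⟨ cong₂ _+_ (sym (∑-*ˡ (suc y) 2 (λ m → 1 * (y ÷ m)))) (sym (trans (∑-const y 1) (*-identityʳ y))) ⟩
  ∑ (suc y) (λ m → 2 * (1 * (y ÷ m))) + ∑ y (λ _ → 1)
    ≤⟨ +-mono-≤ (∑-mono (suc y) low) (∑-mono< y high) ⟩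
  ∑ (suc y) (λ m → 1 * (2 * y ÷ m)) + ∑ y (λ i → 1 * (2 * y ÷ (suc y + i)))
    ≡⟨ ∑-split (suc y) y (λ m → 1 * (2 * y ÷ m)) ⟨
  ∑ (suc y + y) (λ m → 1 * (2 * y ÷ m))
    ≡⟨ cong (λ k → ∑ (suc (y + k)) (λ m → 1 * (2 * y ÷ m))) (sym (+-identityʳ y)) ⟩
  divisorSum [] (2 * y) ∎
  where
  low : ∀ m → 2 * (1 * (y ÷ m)) ≤ 1 * (2 * y ÷ m)
  low zero    = z≤n
  low (suc m) rewrite +-identityʳ (y ÷ suc m) | +-identityʳ (2 * y ÷ suc m) =
    *≤⇒≤÷ (suc m) (2 * (y ÷ suc m)) (begin
      suc m * (2 * (y ÷ suc m))  ≡⟨ swap (suc m) (y ÷ suc m) ⟩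
      2 * (suc m * (y ÷ suc m))  ≤⟨ *-monoʳ-≤ 2 (*÷≤ y (suc m)) ⟩
      2 * y                      ∎)
    where
    swap : ∀ a b → a * (2 * b) ≡ 2 * (a * b)
    swap = solve-∀
  high : ∀ i → i < y → 1 ≤ 1 * (2 * y ÷ (suc y + i))
  high i i<y rewrite +-identityʳ (2 * y ÷ (suc y + i)) = *≤⇒≤÷ (suc y + i) 1 (begin
    (suc y + i) * 1  ≡⟨ trans (*-identityʳ (suc (y + i))) (sym (+-suc y i)) ⟩
    y + suc i        ≤⟨ +-monoʳ-≤ y i<y ⟩
    y + y            ≡⟨ cong (y +_) (+-identityʳ y) ⟨
    2 * y            ∎)

divisorSum-2^ : ∀ s → s * 2 ^ s ≤ 2 * divisorSum [] (2 ^ s)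
divisorSum-2^ zero    = z≤n
divisorSum-2^ (suc s) = begin
  suc s * (2 * 2 ^ s)                           ≡⟨ expand s (2 ^ s) ⟩
  2 * (s * 2 ^ s + 2 ^ s)                       ≤⟨ *-monoʳ-≤ 2 (+-monoˡ-≤ (2 ^ s) (divisorSum-2^ s)) ⟩
  2 * (2 * divisorSum [] (2 ^ s) + 2 ^ s)       ≤⟨ *-monoʳ-≤ 2 (divisorSum-double (2 ^ s)) ⟩
  2 * divisorSum [] (2 ^ suc s)                 ∎
  where
  expand : ∀ s a → suc s * (2 * a) ≡ 2 * (s * a + a)
  expand = solve-∀

∃-prime-divisor : ∀ n → 2 ≤ n → ∃[ p ] (Prime p × p ∣ n)
∃-prime-divisor n@(suc _) 2≤n with factorise n
... | record { factors = [] ; isFactorisation = eq } = contradiction (subst (2 ≤_) eq 2≤n) λ { (s≤s ()) }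
... | record { factors = p ∷ ps ; isFactorisation = eq ; factorsPrime = prime-p ∷ _ } =
  p , prime-p , subst (p ∣_) (sym eq) (m∣m*n _)

-- Every m from 2 to y has a prime divisor in `qs`, so only m = 1 survives. The factor 1 ⊓ y matches
-- the base case of `trunc`, also at y = 0.
divisorSum-sifted : ∀ qs y → (∀ p → Prime p → p ≤ y → p ∈ qs) → divisorSum qs y ≤ y * (1 ⊓ y)
divisorSum-sifted qs zero    all = ≤-reflexive (divisorSum-zero qs)
divisorSum-sifted qs (suc y) all = begin
  divisorSum qs (suc y)
    ≡⟨ trans (∑-suc (suc y) _) (cong (sift qs 0 * 0 +_) (∑-suc y _)) ⟩
  sift qs 0 * 0 + (sift qs 1 * (suc y / 1) + ∑ y F)
    ≡⟨ cong₂ _+_ (*-zeroʳ (sift qs 0)) (cong (sift qs 1 * (suc y / 1) +_) (∑-zero y vanish)) ⟩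
  sift qs 1 * (suc y / 1) + 0
    ≤⟨ +-monoˡ-≤ 0 (*-mono-≤ (sift≤1 qs 1) (≤-reflexive (n/1≡n (suc y)))) ⟩
  1 * suc y + 0
    ≡⟨ rearr (suc y) ⟩
  suc y * 1 ∎
  where
  F : ℕ → ℕ
  F i = sift qs (suc (suc i)) * (suc y ÷ suc (suc i))
  rearr : ∀ a → 1 * a + 0 ≡ a * 1
  rearr = solve-∀
  vanish : ∀ i → i < y → F i ≡ 0
  vanish i i<y with p , prime-p , p∣ ← ∃-prime-divisor (suc (suc i)) (s≤s (s≤s z≤n)) =
    cong (_* (suc y ÷ suc (suc i))) (sift-zero (all p prime-p (≤-trans (∣⇒≤ p∣) (s≤s i<y))) p∣)

-- The sum, over the sublists k of ps with product at most z, of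
-- ∏_{p ∈ k} inn p · ∏_{p ∉ k} out p.
trunc : (out inn : ℕ → ℕ) → List ℕ → ℕ → ℕ
trunc out inn []       z = 1 ⊓ z
trunc out inn (p ∷ ps) z = out p * trunc out inn ps z + inn p * trunc out inn ps (z ÷ p)

prod : (ℕ → ℕ) → List ℕ → ℕ
prod out ps = product (map out ps)

trunc-mono : ∀ out inn ps {y z} → y ≤ z → trunc out inn ps y ≤ trunc out inn ps z
trunc-mono out inn []       y≤z = ⊓-monoʳ-≤ 1 y≤z
trunc-mono out inn (p ∷ ps) y≤z =
  +-mono-≤ (*-monoʳ-≤ (out p) (trunc-mono out inn ps y≤z))
           (*-monoʳ-≤ (inn p) (trunc-mono out inn ps (÷-monoˡ p y≤z)))

T₁ T₂ : List ℕ → ℕ → ℕ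
T₁ = trunc (_∸ 1) (λ _ → 1)
T₂ = trunc (_∸ 2) (λ _ → 2)

Φ₁ Φ₂ : List ℕ → ℕ
Φ₁ = prod (_∸ 1)
Φ₂ = prod (_∸ 2)

-- Group the m ≤ y by squarefree kernel k ≤ y: the reciprocals of all m with kernel k sum to 1/φ(k).
-- The induction moves primes from `ps`, which may still divide m, to `qs`, which are sifted out;
-- the last hypothesis is its invariant.
divisorSum≤T₁ : ∀ ps qs y → All (2 ≤_) ps → (∀ p → Prime p → p ≤ y → p ∈ ps ⊎ p ∈ qs) →
  Φ₁ ps * divisorSum qs y ≤ y * T₁ ps y
divisorSum≤T₁ [] qs y [] all =
  ≤-trans (≤-reflexive (+-identityʳ _))
    (divisorSum-sifted qs y λ p prime-p p≤y → [ (λ ()) , id ]′ (all p prime-p p≤y))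
divisorSum≤T₁ (q@(suc r) ∷ ps) qs y (2≤q ∷ 2≤ps) all = begin
  r * Φ₁ ps * divisorSum qs y
    ≤⟨ step y ⟩
  r * (Φ₁ ps * D′ y) + r * Φ₁ ps * divisorSum qs (y ÷ q)
    -- After one factor q is removed, m may contain further powers of q, whence the weaker `loose`.
    -- Its factor q is paid for by q · (y ÷ q) ≤ y.
    ≤⟨ +-mono-≤ (*-monoʳ-≤ r (rec y ≤-refl)) (loose (y ÷ q) (÷≤ y q)) ⟩
  r * (y * T₁ ps y) + q * ((y ÷ q) * T₁ ps (y ÷ q))
    ≡⟨ cong₂ _+_ (swap r y (T₁ ps y)) (sym (*-assoc q (y ÷ q) (T₁ ps (y ÷ q)))) ⟩
  y * (r * T₁ ps y) + q * (y ÷ q) * T₁ ps (y ÷ q)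
    ≤⟨ +-monoʳ-≤ (y * (r * T₁ ps y)) (*-mono-≤ (*÷≤ y q) (≤-reflexive (sym (+-identityʳ _)))) ⟩
  y * (r * T₁ ps y) + y * (1 * T₁ ps (y ÷ q))
    ≡⟨ *-distribˡ-+ y (r * T₁ ps y) _ ⟨
  y * T₁ (q ∷ ps) y ∎
  where
  swap : ∀ a b c → a * (b * c) ≡ b * (a * c)
  swap = solve-∀
  D′ : ℕ → ℕ
  D′ = divisorSum (q ∷ qs)
  move : ∀ {p} → p ∈ q ∷ ps ⊎ p ∈ qs → p ∈ ps ⊎ p ∈ q ∷ qs
  move (inj₁ (here eq)) = inj₂ (here eq)
  move (inj₁ (there p∈)) = inj₁ p∈
  move (inj₂ p∈) = inj₂ (there p∈)
  rec : ∀ v → v ≤ y → Φ₁ ps * D′ v ≤ v * T₁ ps v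
  rec v v≤y = divisorSum≤T₁ ps (q ∷ qs) v 2≤ps λ p prime-p p≤v → move (all p prime-p (≤-trans p≤v v≤y))
  step : ∀ v → r * Φ₁ ps * divisorSum qs v ≤ r * (Φ₁ ps * D′ v) + r * Φ₁ ps * divisorSum qs (v ÷ q)
  step v = begin
    r * Φ₁ ps * divisorSum qs v
      ≤⟨ *-monoʳ-≤ (r * Φ₁ ps) (divisorSum-step q qs v) ⟩
    r * Φ₁ ps * (D′ v + divisorSum qs (v ÷ q))
      ≡⟨ dist r (Φ₁ ps) (D′ v) _ ⟩
    r * (Φ₁ ps * D′ v) + r * Φ₁ ps * divisorSum qs (v ÷ q) ∎
    where
    dist : ∀ a b c d → a * b * (c + d) ≡ a * (b * c) + a * b * d
    dist = solve-∀
  -- Summing the geometric series in 1/q: D ≤ q/(q-1) · v T.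
  loose : ∀ v → v ≤ y → r * Φ₁ ps * divisorSum qs v ≤ q * (v * T₁ ps v)
  loose = <-rec _ λ
    { zero rec< v≤y → ≤-trans (≤-reflexive (trans (cong (r * Φ₁ ps *_) (divisorSum-zero qs)) (*-zeroʳ (r * Φ₁ ps)))) z≤n
    ; v@(suc _) rec< v≤y → begin
      r * Φ₁ ps * divisorSum qs v
        ≤⟨ step v ⟩
      r * (Φ₁ ps * D′ v) + r * Φ₁ ps * divisorSum qs (v ÷ q)
        ≤⟨ +-mono-≤ (*-monoʳ-≤ r (rec v v≤y)) (rec< (m/n<m v q 2≤q) (≤-trans (÷≤ v q) v≤y)) ⟩
      r * (v * T₁ ps v) + q * ((v ÷ q) * T₁ ps (v ÷ q))
        ≡⟨ cong (r * (v * T₁ ps v) +_) (*-assoc q (v ÷ q) _) ⟨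
      r * (v * T₁ ps v) + q * (v ÷ q) * T₁ ps (v ÷ q)
        ≤⟨ +-monoʳ-≤ (r * (v * T₁ ps v)) (*-mono-≤ (*÷≤ v q) (trunc-mono _ _ ps (÷≤ v q))) ⟩
      r * (v * T₁ ps v) + v * T₁ ps v
        ≡⟨ +-comm (r * (v * T₁ ps v)) _ ⟩
      q * (v * T₁ ps v) ∎ }

primes≤ : ℕ → List ℕ
primes≤ n = filter prime? (downFrom (suc n))

prime⇒2≤ : ∀ {p} → Prime p → 2 ≤ p
prime⇒2≤ prime-p = nonTrivial⇒n>1 _ {{prime⇒nonTrivial prime-p}}

∈-primes≤⁺ : ∀ {n p} → Prime p → p ≤ n → p ∈ primes≤ n
∈-primes≤⁺ prime-p p≤n = ∈-filter⁺ prime? (∈-downFrom⁺ (s≤s p≤n)) prime-p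

-- Mertens' theorem, as a lower bound: T₁ / Φ₁ = Σ_{k ≤ 2^s squarefree} 1/φ(k) ≥ Σ_{m ≤ 2^s} 1/m.
T₁-lower : ∀ s → s * Φ₁ (primes≤ (2 ^ s)) ≤ 2 * T₁ (primes≤ (2 ^ s)) (2 ^ s)
T₁-lower s = *-cancelˡ-≤ (2 ^ s) {{m^n≢0 2 s}} (begin
  2 ^ s * (s * Φ₁ ps)             ≡⟨ rearr₁ (2 ^ s) s (Φ₁ ps) ⟩
  Φ₁ ps * (s * 2 ^ s)             ≤⟨ *-monoʳ-≤ (Φ₁ ps) (divisorSum-2^ s) ⟩
  Φ₁ ps * (2 * divisorSum [] (2 ^ s)) ≡⟨ rearr₂ (Φ₁ ps) _ ⟩
  2 * (Φ₁ ps * divisorSum [] (2 ^ s)) ≤⟨ *-monoʳ-≤ 2 (divisorSum≤T₁ ps [] (2 ^ s)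
    (All.map prime⇒2≤ (all-filter prime? (downFrom (suc (2 ^ s)))))
    λ p prime-p p≤ → inj₁ (∈-primes≤⁺ prime-p p≤)) ⟩
  2 * (2 ^ s * T₁ ps (2 ^ s))     ≡⟨ rearr₃ (2 ^ s) _ ⟩
  2 ^ s * (2 * T₁ ps (2 ^ s))     ∎)
  where
  ps = primes≤ (2 ^ s)
  rearr₁ : ∀ a b c → a * (b * c) ≡ c * (b * a)
  rearr₁ = solve-∀
  rearr₂ : ∀ a b → a * (2 * b) ≡ 2 * (a * b)
  rearr₂ = solve-∀
  rearr₃ : ∀ a b → 2 * (a * b) ≡ a * (2 * b)
  rearr₃ = solve-∀

∑-unique : ∀ {P : ℕ → Set} (P? : Decidable P) n k → k < n → P k → (∀ i → i < n → P i → i ≡ k) →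
  ∑ n (λ i → ⟦ P? i ⟧) ≡ 1
∑-unique P? (suc n) zero k<n Pk uniq = trans (∑-suc n _) (cong₂ _+_ (⟦⟧-yes (P? 0) Pk)
  (∑-zero n λ i i<n → ⟦⟧-no (P? (suc i)) λ Pi → contradiction (uniq (suc i) (s<s i<n) Pi) λ ()))
∑-unique P? (suc n) (suc k) k<n Pk uniq = trans (∑-suc n _) (cong₂ _+_
  (⟦⟧-no (P? 0) λ P0 → contradiction (uniq 0 z<s P0) λ ())
  (∑-unique (P? ∘ suc) n k (s<s⁻¹ k<n) Pk λ i i<n Pi → suc-injective (uniq (suc i) (s<s i<n) Pi)))

-- From the Mertens sum to the sieve sum over primes not dividing 2d

*-^-self : ∀ m k → (m * m) ^ k ≡ m ^ k * m ^ k
*-^-self m zero    = refl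
*-^-self m (suc k) = trans (cong (m * m *_) (*-^-self m k)) ([m*n]*[o*p]≡[m*o]*[n*p] m m (m ^ k) (m ^ k))

prod-pos : ∀ out {ps} → All (λ p → 1 ≤ out p) ps → 1 ≤ prod out ps
prod-pos out []           = ≤-refl
prod-pos out (le ∷ les) = *-mono-≤ le (prod-pos out les)

-- Without truncation the factors (p-1) + 1 multiply to the product of the p. Together with
-- `T₁-lower` this gives P/φ(P) ≥ t/2.
T₁≤product : ∀ {ps} y → All (1 ≤_) ps → T₁ ps y ≤ product ps
T₁≤product y [] = m⊓n≤m 1 y
T₁≤product {suc r ∷ ps} y (_ ∷ 1≤ps) = begin
  r * T₁ ps y + 1 * T₁ ps (y ÷ suc r) ≤⟨ +-mono-≤ (*-monoʳ-≤ r (T₁≤product y 1≤ps)) (*-monoʳ-≤ 1 (T₁≤product (y ÷ suc r) 1≤ps)) ⟩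
  r * product ps + 1 * product ps         ≡⟨ rearr r (product ps) ⟩
  suc r * product ps                    ∎
  where
  rearr : ∀ r a → r * a + 1 * a ≡ suc r * a
  rearr = solve-∀

-- Dropping a prime from the sum `T₁`/`Φ₁` costs at most a factor 1 + 1/(p-1) ≤ 2.
T₁-filter : ∀ {U : ℕ → Set} (U? : Decidable U) {ps} y → All (2 ≤_) ps →
  T₁ ps y * Φ₁ (filter (¬? ∘ U?) ps) ≤ 2 ^ length (filter U? ps) * Φ₁ ps * T₁ (filter (¬? ∘ U?) ps) y
T₁-filter U? y [] = ≤-reflexive (rearr (1 ⊓ y))
  where
  rearr : ∀ a → a * 1 ≡ 1 * 1 * a
  rearr = solve-∀
T₁-filter U? {suc r ∷ ps} y (s≤s 1≤r ∷ 2≤ps) with U? (suc r)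
... | no _ = begin
  (r * T₁ ps y + 1 * T₁ ps y′) * (r * Φ₁ qs)
    ≡⟨ rearr₁ r (T₁ ps y) (T₁ ps y′) (Φ₁ qs) ⟩
  r * (r * (T₁ ps y * Φ₁ qs) + T₁ ps y′ * Φ₁ qs)
    ≤⟨ *-monoʳ-≤ r (+-mono-≤ (*-monoʳ-≤ r (T₁-filter U? y 2≤ps)) (T₁-filter U? y′ 2≤ps)) ⟩
  r * (r * (E * Φ₁ ps * T₁ qs y) + E * Φ₁ ps * T₁ qs y′)
    ≡⟨ rearr₂ r E (Φ₁ ps) (T₁ qs y) (T₁ qs y′) ⟩
  E * (r * Φ₁ ps) * (r * T₁ qs y + 1 * T₁ qs y′) ∎
  where
  y′ = y ÷ suc r
  qs = filter (¬? ∘ U?) ps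
  E = 2 ^ length (filter U? ps)
  rearr₁ : ∀ r a b c → (r * a + 1 * b) * (r * c) ≡ r * (r * (a * c) + b * c)
  rearr₁ = solve-∀
  rearr₂ : ∀ r e f a b → r * (r * (e * f * a) + e * f * b) ≡ e * (r * f) * (r * a + 1 * b)
  rearr₂ = solve-∀
... | yes _ = begin
  (r * T₁ ps y + 1 * T₁ ps y′) * Φ₁ qs
    ≤⟨ *-monoˡ-≤ (Φ₁ qs) (+-monoʳ-≤ (r * T₁ ps y) (*-mono-≤ 1≤r (trunc-mono _ _ ps (÷≤ y (suc r))))) ⟩
  (r * T₁ ps y + r * T₁ ps y) * Φ₁ qs
    ≡⟨ rearr₁ r (T₁ ps y) (Φ₁ qs) ⟩
  2 * r * (T₁ ps y * Φ₁ qs)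
    ≤⟨ *-monoʳ-≤ (2 * r) (T₁-filter U? y 2≤ps) ⟩
  2 * r * (E * Φ₁ ps * T₁ qs y)
    ≡⟨ rearr₂ r E (Φ₁ ps) (T₁ qs y) ⟩
  2 * E * (r * Φ₁ ps) * T₁ qs y ∎
  where
  y′ = y ÷ suc r
  qs = filter (¬? ∘ U?) ps
  E = 2 ^ length (filter U? ps)
  rearr₁ : ∀ r a c → (r * a + r * a) * c ≡ 2 * r * (a * c)
  rearr₁ = solve-∀
  rearr₂ : ∀ r e f a → 2 * r * (e * f * a) ≡ 2 * e * (r * f) * a
  rearr₂ = solve-∀

-- Termwise this is 2/(p-1) + 1/(p-1)² ≤ 2/(p-2).
T₁T₁≤T₂ : ∀ {ps} y z → All (2 ≤_) ps →
  T₁ ps y * T₁ ps z * Φ₂ ps ≤ Φ₁ ps * Φ₁ ps * T₂ ps (y * z)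
T₁T₁≤T₂ {[]} y z [] = ≤-trans (≤-reflexive (*-identityʳ _)) (≤-trans (1⊓-* y z) (≤-reflexive (sym (+-identityʳ _))))
  where
  1⊓-* : ∀ y z → (1 ⊓ y) * (1 ⊓ z) ≤ 1 ⊓ (y * z)
  1⊓-* zero z = z≤n
  1⊓-* (suc y) zero = z≤n
  1⊓-* (suc y) (suc z) = ≤-refl
T₁T₁≤T₂ {suc zero ∷ ps} y z (s≤s () ∷ _)
T₁T₁≤T₂ {p@(suc (suc k)) ∷ ps} y z (_ ∷ 2≤ps) = begin
  (r * a + 1 * a′) * (r * b + 1 * b′) * (k * f)
    ≡⟨ rearr₁ k a a′ b b′ f ⟩
  r * r * k * (a * b * f) + r * k * (a * b′ * f) + r * k * (a′ * b * f) + k * (a′ * b′ * f)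
    ≤⟨ +-mono-≤ (+-mono-≤ (+-mono-≤
         (*-monoʳ-≤ (r * r * k) (T₁T₁≤T₂ y z 2≤ps))
         (*-monoʳ-≤ (r * k) (≤-trans (T₁T₁≤T₂ y (z ÷ p) 2≤ps) (shrink right))))
         (*-monoʳ-≤ (r * k) (≤-trans (T₁T₁≤T₂ (y ÷ p) z 2≤ps) (shrink left))))
         (*-monoʳ-≤ k (≤-trans (T₁T₁≤T₂ (y ÷ p) (z ÷ p) 2≤ps) (shrink both))) ⟩
  r * r * k * (g * g * t) + r * k * (g * g * t′) + r * k * (g * g * t′) + k * (g * g * t′)
    -- The coefficient of g²t′ must reach 2(k+1)², and 2k(k+1) + k is present; the difference is k +
    -- 2.
    ≤⟨ m≤m+n _ ((k + 2) * (g * g * t′)) ⟩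
  r * r * k * (g * g * t) + r * k * (g * g * t′) + r * k * (g * g * t′) + k * (g * g * t′)
    + (k + 2) * (g * g * t′)
    ≡⟨ rearr₂ k g t t′ ⟩
  r * g * (r * g) * (k * t + 2 * t′) ∎
  where
  r = suc k
  a = T₁ ps y
  a′ = T₁ ps (y ÷ p)
  b = T₁ ps z
  b′ = T₁ ps (z ÷ p)
  f = Φ₂ ps
  g = Φ₁ ps
  t = T₂ ps (y * z)
  t′ = T₂ ps (y * z ÷ p)
  shrink : ∀ {v} → v ≤ y * z ÷ p → g * g * T₂ ps v ≤ g * g * t′
  shrink le = *-monoʳ-≤ (g * g) (trunc-mono _ _ ps le)
  right : y * (z ÷ p) ≤ y * z ÷ p
  right = *≤⇒≤÷ p (y * (z ÷ p)) (begin
    p * (y * (z ÷ p)) ≡⟨ swap p y (z ÷ p) ⟩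
    y * (p * (z ÷ p)) ≤⟨ *-monoʳ-≤ y (*÷≤ z p) ⟩
    y * z ∎)
    where
    swap : ∀ a b c → a * (b * c) ≡ b * (a * c)
    swap = solve-∀
  left : (y ÷ p) * z ≤ y * z ÷ p
  left = *≤⇒≤÷ p ((y ÷ p) * z) (begin
    p * ((y ÷ p) * z) ≡⟨ *-assoc p (y ÷ p) z ⟨
    p * (y ÷ p) * z ≤⟨ *-monoˡ-≤ z (*÷≤ y p) ⟩
    y * z ∎)
  -- A prime lying in both sublists enters their union once, so one of the two divisions by p is
  -- given up.
  both : (y ÷ p) * (z ÷ p) ≤ y * z ÷ p
  both = ≤-trans (*-monoʳ-≤ (y ÷ p) (÷≤ z p)) left
  rearr₁ : ∀ k a a′ b b′ f → (suc k * a + 1 * a′) * (suc k * b + 1 * b′) * (k * f) ≡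
    suc k * suc k * k * (a * b * f) + suc k * k * (a * b′ * f) + suc k * k * (a′ * b * f) + k * (a′ * b′ * f)
  rearr₁ = solve-∀
  rearr₂ : ∀ k g t t′ → suc k * suc k * k * (g * g * t) + suc k * k * (g * g * t′) + suc k * k * (g * g * t′) + k * (g * g * t′)
    + (k + 2) * (g * g * t′) ≡ suc k * g * (suc k * g) * (k * t + 2 * t′)
  rearr₂ = solve-∀

length-primes∣2* : ∀ d .{{_ : NonZero d}} n → length (filter (_∣? 2 * d) (filter prime? (downFrom n))) ≤ ω d + 1
length-primes∣2* d n = begin
  length (filter (_∣? 2 * d) (filter prime? (downFrom n)))
    ≤⟨ count n ⟩
  ∑ n (λ i → ⟦ Q? i ⟧) + ∑ n (λ i → ⟦ i ≟ 2 ⟧)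
    ≤⟨ +-mono-≤ (∑-trim (suc d) n λ i d<i → ⟦⟧-no (Q? i) λ (_ , i∣d) → >⇒∤ d<i i∣d)
                (∑-trim 3 n λ i 2<i → ⟦⟧-no (i ≟ 2) λ { refl → <-irrefl refl 2<i }) ⟩
  ∑ (suc d) (λ i → ⟦ Q? i ⟧) + ∑ 3 (λ i → ⟦ i ≟ 2 ⟧)
    ≡⟨ cong₂ _+_ (sym (length-filter-applyUpTo Q? id (suc d))) (∑-unique (_≟ 2) 3 2 ≤-refl refl λ i _ eq → eq) ⟩
  ω d + 1 ∎
  where
  Q? : ∀ i → Dec (Prime i × i ∣ d)
  Q? i = prime? i ×-dec (i ∣? d)
  count : ∀ n → length (filter (_∣? 2 * d) (filter prime? (downFrom n))) ≤ ∑ n (λ i → ⟦ Q? i ⟧) + ∑ n (λ i → ⟦ i ≟ 2 ⟧)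
  count zero = z≤n
  count (suc n) = begin
    length (filter (_∣? 2 * d) (filter prime? (n ∷ downFrom n)))
      ≤⟨ hd _ one ⟩
    A + (⟦ Q? n ⟧ + ⟦ n ≟ 2 ⟧)
      ≤⟨ +-monoˡ-≤ _ (count n) ⟩
    ∑ n q + ∑ n e + (⟦ Q? n ⟧ + ⟦ n ≟ 2 ⟧)
      ≡⟨ rearr (∑ n q) (∑ n e) ⟦ Q? n ⟧ ⟦ n ≟ 2 ⟧ ⟩
    (∑ n q + ⟦ Q? n ⟧) + (∑ n e + ⟦ n ≟ 2 ⟧)
      ≡⟨ cong₂ _+_ (∑-last n q) (∑-last n e) ⟨
    ∑ (suc n) q + ∑ (suc n) e ∎
    where
    q e : ℕ → ℕ
    q i = ⟦ Q? i ⟧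
    e i = ⟦ i ≟ 2 ⟧
    A = length (filter (_∣? 2 * d) (filter prime? (downFrom n)))
    rearr : ∀ a b c d → a + b + (c + d) ≡ (a + c) + (b + d)
    rearr = solve-∀
    one : Prime n → n ∣ 2 * d → 1 ≤ ⟦ Q? n ⟧ + ⟦ n ≟ 2 ⟧
    one prime-n n∣2d with euclidsLemma 2 d prime-n n∣2d
    ... | inj₂ n∣d = ≤-trans (≤-reflexive (sym (⟦⟧-yes (Q? n) (prime-n , n∣d)))) (m≤m+n _ _)
    ... | inj₁ n∣2 = ≤-trans (≤-reflexive (sym (⟦⟧-yes (n ≟ 2) (≤-antisym (∣⇒≤ n∣2) (prime⇒2≤ prime-n)))))
                             (m≤n+m ⟦ n ≟ 2 ⟧ ⟦ Q? n ⟧)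
    hd : ∀ k → (Prime n → n ∣ 2 * d → 1 ≤ k) → length (filter (_∣? 2 * d) (filter prime? (n ∷ downFrom n))) ≤ A + k
    hd k 1≤k with prime? n
    ... | no ¬prime-n = m≤m+n A _
    ... | yes prime-n with n ∣? 2 * d
    ...   | no _ = m≤m+n A _
    ...   | yes n∣2d = ≤-trans (≤-reflexive (+-comm 1 A)) (+-monoʳ-≤ A (1≤k prime-n n∣2d))

sievers : ℕ → ℕ → List ℕ
sievers d n = filter (¬? ∘ (_∣? 2 * d)) (primes≤ n)

primes≤-2≤ : ∀ n → All (2 ≤_) (primes≤ n)
primes≤-2≤ n = All.map prime⇒2≤ (all-filter prime? (downFrom (suc n)))

-- Mertens' bound squared. Each of the two factors loses 2 in `T₁-lower` and at most 2^M to the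
-- primes dividing 2d: at most ω(d) of them divide d, and there is the prime 2. The truncations
-- multiply, whence the level 2^s · 2^s.
T₂-lower : ∀ d .{{_ : NonZero d}} s M → ω d < M →
  s * s * Φ₂ (sievers d (2 ^ s)) ≤ 4 ^ suc M * T₂ (sievers d (2 ^ s)) (2 ^ s * 2 ^ s)
T₂-lower d s M ω<M = *-cancelˡ-≤ (Φ₁ qs * Φ₁ qs) {{>-nonZero (*-mono-≤ Φ₁qs>0 Φ₁qs>0)}} (begin
  Φ₁ qs * Φ₁ qs * (s * s * Φ₂ qs)
    ≡⟨ rearr₁ (Φ₁ qs) s (Φ₂ qs) ⟩
  (s * Φ₁ qs) * (s * Φ₁ qs) * Φ₂ qs
    ≤⟨ *-monoˡ-≤ (Φ₂ qs) (*-mono-≤ linear linear) ⟩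
  (2 ^ suc M * T₁ qs z) * (2 ^ suc M * T₁ qs z) * Φ₂ qs
    ≡⟨ rearr₂ (2 ^ suc M) (T₁ qs z) (Φ₂ qs) ⟩
  2 ^ suc M * 2 ^ suc M * (T₁ qs z * T₁ qs z * Φ₂ qs)
    ≤⟨ *-monoʳ-≤ (2 ^ suc M * 2 ^ suc M) (T₁T₁≤T₂ z z (filter⁺ _ (primes≤-2≤ z))) ⟩
  2 ^ suc M * 2 ^ suc M * (Φ₁ qs * Φ₁ qs * T₂ qs (z * z))
    ≡⟨ cong (_* (Φ₁ qs * Φ₁ qs * T₂ qs (z * z))) (*-^-self 2 (suc M)) ⟨
  4 ^ suc M * (Φ₁ qs * Φ₁ qs * T₂ qs (z * z))
    ≡⟨ rearr₃ (4 ^ suc M) (Φ₁ qs * Φ₁ qs) _ ⟩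
  Φ₁ qs * Φ₁ qs * (4 ^ suc M * T₂ qs (z * z)) ∎)
  where
  z = 2 ^ s
  ps = primes≤ z
  qs = sievers d z
  2≤ps = primes≤-2≤ z
  pred-pos : ∀ {p} → 2 ≤ p → 1 ≤ p ∸ 1
  pred-pos (s≤s le) = le
  Φ₁ps>0 : 1 ≤ Φ₁ ps
  Φ₁ps>0 = prod-pos _ (All.map pred-pos 2≤ps)
  Φ₁qs>0 : 1 ≤ Φ₁ qs
  Φ₁qs>0 = prod-pos _ (All.map pred-pos (filter⁺ _ 2≤ps))
  rearr₁ : ∀ a s f → a * a * (s * s * f) ≡ (s * a) * (s * a) * f
  rearr₁ = solve-∀
  rearr₂ : ∀ e a f → (e * a) * (e * a) * f ≡ e * e * (a * a * f)
  rearr₂ = solve-∀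
  rearr₃ : ∀ a b c → a * (b * c) ≡ b * (a * c)
  rearr₃ = solve-∀
  rearr₄ : ∀ a b c → a * (b * c) ≡ b * a * c
  rearr₄ = solve-∀
  rearr₅ : ∀ e f a → 2 * (e * f * a) ≡ f * (2 * e * a)
  rearr₅ = solve-∀
  linear : s * Φ₁ qs ≤ 2 ^ suc M * T₁ qs z
  linear = *-cancelˡ-≤ (Φ₁ ps) {{>-nonZero Φ₁ps>0}} (begin
    Φ₁ ps * (s * Φ₁ qs)
      ≡⟨ rearr₄ (Φ₁ ps) s (Φ₁ qs) ⟩
    s * Φ₁ ps * Φ₁ qs
      ≤⟨ *-monoˡ-≤ (Φ₁ qs) (T₁-lower s) ⟩
    2 * T₁ ps z * Φ₁ qs
      ≡⟨ *-assoc 2 (T₁ ps z) (Φ₁ qs) ⟩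
    2 * (T₁ ps z * Φ₁ qs)
      ≤⟨ *-monoʳ-≤ 2 (T₁-filter (_∣? 2 * d) z 2≤ps) ⟩
    2 * (2 ^ length (filter (_∣? 2 * d) ps) * Φ₁ ps * T₁ qs z)
      ≤⟨ *-monoʳ-≤ 2 (*-monoˡ-≤ (T₁ qs z) (*-monoˡ-≤ (Φ₁ ps) (^-monoʳ-≤ 2 few))) ⟩
    2 * (2 ^ M * Φ₁ ps * T₁ qs z)
      ≡⟨ rearr₅ (2 ^ M) (Φ₁ ps) (T₁ qs z) ⟩
    Φ₁ ps * (2 ^ suc M * T₁ qs z) ∎)
    where
    few : length (filter (_∣? 2 * d) ps) ≤ M
    few = ≤-trans (length-primes∣2* d (suc z)) (≤-trans (≤-reflexive (+-comm (ω d) 1)) ω<M)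

-- Solutions of congruences

prime∤⇒coprime : ∀ {p q} → Prime p → ¬ p ∣ q → Coprime p q
prime∤⇒coprime prime-p p∤q (i∣p , i∣q) with prime⇒irreducible prime-p i∣p
... | inj₁ i≡1  = i≡1
... | inj₂ refl = contradiction i∣q p∤q

prime∣prime⇒≡ : ∀ {p q} → Prime p → Prime q → p ∣ q → p ≡ q
prime∣prime⇒≡ prime-p prime-q p∣q with prime⇒irreducible prime-q p∣q
... | inj₁ refl = contradiction prime-p ¬prime[1]
... | inj₂ p≡q  = p≡q

∃-solution : ∀ {p q} → Prime p → ¬ p ∣ q → ∀ r → ∃[ i ] (i < p × p ∣ r + i * q)
∃-solution {p@(suc p′)} {q} prime-p p∤q r = i % p , m%n<n i p , ∣m+n∣m⇒∣n (subst (p ∣_) reduce i-solves) (n∣m*n (i / p * q))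
  where
  solution : ∃[ i ] p ∣ r + i * q
  solution with coprime-Bézout (prime∤⇒coprime prime-p p∤q)
  ... | Bézout.+- x y eq = r * y , divides (r * x) (begin-equality
    r + r * y * q    ≡⟨ rearr₁ r y q ⟩
    r * (1 + y * q)  ≡⟨ cong (r *_) eq ⟩
    r * (x * p)      ≡⟨ *-assoc r x p ⟨
    r * x * p        ∎)
    where
    rearr₁ : ∀ r y q → r + r * y * q ≡ r * (1 + y * q)
    rearr₁ = solve-∀
  -- Here y·q is 1 modulo p, so a solution needs the factor -1; p′ = p - 1 supplies it in ℕ.
  ... | Bézout.-+ x y eq = r * p′ * y , divides (r + r * p′ * x) (begin-equality
    r + r * p′ * y * q           ≡⟨ cong (r +_) (*-assoc (r * p′) y q) ⟩
    r + r * p′ * (y * q)         ≡⟨ cong (λ e → r + r * p′ * e) eq ⟨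
    r + r * p′ * (1 + x * p)     ≡⟨ rearr₂ r p′ x ⟩
    (r + r * p′ * x) * p         ∎)
    where
    rearr₂ : ∀ r p′ x → r + r * p′ * (1 + x * suc p′) ≡ (r + r * p′ * x) * suc p′
    rearr₂ = solve-∀
  i = proj₁ solution
  i-solves = proj₂ solution
  reduce : r + i * q ≡ i / p * q * p + (r + i % p * q)
  reduce = begin-equality
    r + i * q                       ≡⟨ cong (λ e → r + e * q) (m≡m%n+[m/n]*n i p) ⟩
    r + (i % p + i / p * p) * q     ≡⟨ rearr₃ r (i % p) (i / p) p q ⟩
    i / p * q * p + (r + i % p * q) ∎
    where
    rearr₃ : ∀ r a b p q → r + (a + b * p) * q ≡ b * q * p + (r + a * q)
    rearr₃ = solve-∀

solution-unique : ∀ {p q} → Prime p → ¬ p ∣ q → ∀ r i j → i < p → j < p → p ∣ r + i * q → p ∣ r + j * q → i ≡ j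
solution-unique {p} {q} prime-p p∤q r i j i<p j<p p∣i p∣j =
  [ (λ i≤j → ordered i j i≤j j<p p∣i p∣j) , (λ j≤i → sym (ordered j i j≤i i<p p∣j p∣i)) ]′ (≤-total i j)
  where
  rearr : ∀ r i k q → r + (i + k) * q ≡ r + i * q + k * q
  rearr = solve-∀
  ordered : ∀ i j → i ≤ j → j < p → p ∣ r + i * q → p ∣ r + j * q → i ≡ j
  ordered i j i≤j j<p p∣i p∣j with m≤n⇒∃[o]m+o≡n i≤j
  ... | zero , refl = sym (+-identityʳ i)
  ... | suc k , refl with euclidsLemma (suc k) q prime-p (∣m+n∣m⇒∣n (subst (p ∣_) (rearr r i (suc k) q) p∣j) p∣i)
  ...   | inj₁ p∣k = contradiction p∣k (>⇒∤ (≤-<-trans (m≤n+m (suc k) i) j<p))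
  ...   | inj₂ p∣q = contradiction p∣q p∤q

count-solutions : ∀ {p q} → Prime p → ¬ p ∣ q → ∀ r → ∑ p (λ i → ⟦ p ∣? r + i * q ⟧) ≡ 1
count-solutions {p} {q} prime-p p∤q r with k , k<p , p∣k ← ∃-solution prime-p p∤q r =
  ∑-unique (λ i → p ∣? r + i * q) p k k<p p∣k λ i i<p p∣i → solution-unique prime-p p∤q r i k i<p k<p p∣i p∣k

∣?-period : ∀ p n q → p ∣ q → ⟦ p ∣? n + q ⟧ ≡ ⟦ p ∣? n ⟧
∣?-period p n q p∣q = ≤-antisym
  (⟦⟧-mono (p ∣? n + q) (p ∣? n) (λ p∣n+q → ∣m+n∣m⇒∣n (subst (p ∣_) (+-comm n q) p∣n+q) p∣q))
  (⟦⟧-mono (p ∣? n) (p ∣? n + q) (λ p∣n → ∣m∣n⇒∣m+n p∣n p∣q))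

∤?-period : ∀ p n q → p ∣ q → ⟦ ¬? (p ∣? n + q) ⟧ ≡ ⟦ ¬? (p ∣? n) ⟧
∤?-period p n q p∣q = +-cancelʳ-≡ ⟦ p ∣? n ⟧ _ _ (trans (cong (⟦ ¬? (p ∣? n + q) ⟧ +_) (sym (∣?-period p n q p∣q)))
  (trans (⟦⟧-¬ (p ∣? n + q)) (sym (⟦⟧-¬ (p ∣? n)))))

sift-period : ∀ ps n q → product ps ∣ q → sift ps (n + q) ≡ sift ps n
sift-period []       n q ∣q = refl
sift-period (p ∷ ps) n q ∣q = cong₂ _*_ (∤?-period p n q (m*n∣⇒m∣ p (product ps) ∣q))
                                        (sift-period ps n q (m*n∣⇒n∣ p (product ps) ∣q))

∑-sift : ∀ {ps} → Unique ps → All Prime ps → ∑ (product ps) (sift ps) ≡ Φ₁ ps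
∑-sift [] [] = trans (∑-last 0 _) (cong (_+ 1) (∑-zero 0 λ _ ()))
∑-sift {p ∷ ps} (p∉ps ∷ uniq) (prime-p ∷ primes) = begin-equality
  ∑ (p * product ps) (λ n → ⟦ ¬? (p ∣? n) ⟧ * sift ps n)
    ≡⟨ ∑-cong (p * product ps) (λ n → *-comm ⟦ ¬? (p ∣? n) ⟧ (sift ps n)) ⟩
  ∑ (p * product ps) (λ n → sift ps n * ⟦ ¬? (p ∣? n) ⟧)
    ≡⟨ ∑-crt p (product ps) (sift ps) _ (p ∸ 1) (λ n → sift-period ps n _ ∣-refl) avoid ⟩
  ∑ (product ps) (sift ps) * (p ∸ 1)
    ≡⟨ cong (_* (p ∸ 1)) (∑-sift uniq primes) ⟩
  Φ₁ ps * (p ∸ 1)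
    ≡⟨ *-comm (Φ₁ ps) (p ∸ 1) ⟩
  Φ₁ (p ∷ ps) ∎
  where
  p∤ : ¬ p ∣ product ps
  p∤ p∣ = All.lookup p∉ps (factorisationHasAllPrimeFactors prime-p p∣ primes) refl
  avoid : ∀ r → ∑ p (λ i → ⟦ ¬? (p ∣? r + i * product ps) ⟧) ≡ p ∸ 1
  avoid r = sym (m+n≡o⇒m≡o∸n _ _ _ (begin-equality
    ∑ p (λ i → ⟦ ¬? (p ∣? r + i * product ps) ⟧) + 1
      ≡⟨ cong (∑ p (λ i → ⟦ ¬? (p ∣? r + i * product ps) ⟧) +_) (count-solutions prime-p p∤ r) ⟨
    ∑ p (λ i → ⟦ ¬? (p ∣? r + i * product ps) ⟧) + ∑ p (λ i → ⟦ p ∣? r + i * product ps ⟧)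
      ≡⟨ ∑-+ p _ _ ⟨
    ∑ p (λ i → ⟦ ¬? (p ∣? r + i * product ps) ⟧ + ⟦ p ∣? r + i * product ps ⟧)
      ≡⟨ ∑-cong p (λ i → ⟦⟧-¬ (p ∣? r + i * product ps)) ⟩
    ∑ p (λ _ → 1)
      ≡⟨ trans (∑-const p 1) (*-identityʳ p) ⟩
    p ∎))
    where
    m+n≡o⇒m≡o∸n : ∀ m n o → m + n ≡ o → o ∸ n ≡ m
    m+n≡o⇒m≡o∸n m n o refl = m+n∸n≡m m n

-- The sieve

module Sumℤ = Sum ℤ.+-*-commutativeSemiring
open Sumℤ using () renaming (∑ to ∑ℤ)

∑ℤ-pos : ∀ n f → ∑ℤ n (λ i → pos (f i)) ≡ pos (∑ n f)
∑ℤ-pos zero    f = trans (Sumℤ.∑-zero 0 λ _ ()) (cong pos (sym (∑-zero 0 λ _ ())))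
∑ℤ-pos (suc n) f = trans (Sumℤ.∑-suc n _) (trans (cong (pos (f 0) +′_) (∑ℤ-pos n (f ∘ suc))) (cong pos (sym (∑-suc n f))))

∑ℤ-affine : ∀ n a b f → ∑ℤ n (λ i → a +′ b *′ pos (f i)) ≡ pos n *′ a +′ b *′ pos (∑ n f)
∑ℤ-affine n a b f = trans (Sumℤ.∑-+ n _ _) (cong₂ _+′_ (const n) (trans (Sumℤ.∑-*ˡ n b _) (cong (b *′_) (∑ℤ-pos n f))))
  where
  const : ∀ n → ∑ℤ n (λ _ → a) ≡ pos n *′ a
  const zero    = Sumℤ.∑-zero 0 λ _ ()
  const (suc n) = trans (Sumℤ.∑-suc n _) (trans (cong (a +′_) (const n)) (sym (ℤ.suc-* (pos n) a)))

∣∑∣≤ : ∀ n f F → (∀ i → ∣ f i ∣ ≤ F) → ∣ ∑ℤ n f ∣ ≤ n * F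
∣∑∣≤ zero    f F bound = ≤-reflexive (cong ∣_∣ (Sumℤ.∑-zero 0 {f} λ _ ()))
∣∑∣≤ (suc n) f F bound = ≤-trans (≤-reflexive (cong ∣_∣ (Sumℤ.∑-suc n f)))
  (≤-trans (ℤ.∣i+j∣≤∣i∣+∣j∣ (f 0) _) (+-mono-≤ (bound 0) (∣∑∣≤ n (f ∘ suc) F (bound ∘ suc))))

-- Complete periods cancel exactly, and fewer than q terms remain. The factor q in front replaces
-- division of the period sum by q.
periodic-sum : ∀ N f q .{{_ : NonZero q}} F → (∀ n → f (n + q) ≡ f n) → (∀ n → ∣ f n ∣ ≤ F) →
  ∣ pos q *′ ∑ℤ N f -′ pos N *′ ∑ℤ q f ∣ ≤ q * (2 * (q * F))
periodic-sum N f q F period bound = begin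
  ∣ pos q *′ ∑ℤ N f -′ pos N *′ s ∣
    ≡⟨ cong ∣_∣ (cong₂ (λ u v → pos q *′ u -′ v *′ s) sum-N pos-N) ⟩
  ∣ pos q *′ (pos a *′ s +′ ∑ℤ b f) -′ (pos b +′ pos a *′ pos q) *′ s ∣
    ≡⟨ cong ∣_∣ (rearr (pos q) (pos a) (pos b) s (∑ℤ b f)) ⟩
  ∣ pos q *′ ∑ℤ b f -′ pos b *′ s ∣
    ≤⟨ ℤ.∣i-j∣≤∣i∣+∣j∣ (pos q *′ ∑ℤ b f) (pos b *′ s) ⟩
  ∣ pos q *′ ∑ℤ b f ∣ + ∣ pos b *′ s ∣
    ≡⟨ cong₂ _+_ (ℤ.abs-* (pos q) (∑ℤ b f)) (ℤ.abs-* (pos b) s) ⟩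
  q * ∣ ∑ℤ b f ∣ + b * ∣ s ∣
    ≤⟨ +-mono-≤ (*-monoʳ-≤ q (≤-trans (∣∑∣≤ b f F bound) (*-monoˡ-≤ F b≤q))) (*-mono-≤ b≤q (∣∑∣≤ q f F bound)) ⟩
  q * (q * F) + q * (q * F)
    ≡⟨ double q (q * F) ⟩
  q * (2 * (q * F)) ∎
  where
  a = N / q
  b = N % q
  s = ∑ℤ q f
  b≤q : b ≤ q
  b≤q = m%n≤n N q
  double : ∀ x y → x * y + x * y ≡ x * (2 * y)
  double = solve-∀
  rearr : ∀ q a b s t → q *′ (a *′ s +′ t) -′ (b +′ a *′ q) *′ s ≡ q *′ t -′ b *′ s
  rearr = ℤ-Solver.solve-∀
  N≡ : N ≡ b + a * q
  N≡ = m≡m%n+[m/n]*n N q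
  pos-N : pos N ≡ pos b +′ pos a *′ pos q
  pos-N = trans (cong pos N≡) (cong (pos b +′_) (ℤ.pos-* a q))
  blocks : ∀ a → ∑ℤ (a * q) f ≡ pos a *′ s
  blocks zero    = Sumℤ.∑-zero 0 λ _ ()
  blocks (suc a) = trans (Sumℤ.∑-split q (a * q) f)
    (trans (cong (s +′_) (trans (Sumℤ.∑-cong (a * q) λ i → trans (cong f (+-comm q i)) (period i)) (blocks a)))
           (sym (ℤ.suc-* (pos a) s)))
  sum-N : ∑ℤ N f ≡ pos a *′ s +′ ∑ℤ b f
  sum-N = trans (cong (λ m → ∑ℤ m f) (trans N≡ (+-comm b (a * q)))) (trans (Sumℤ.∑-split (a * q) b f)
    (cong₂ _+′_ (blocks a) (Sumℤ.∑-cong b λ i → trans (cong f (+-comm (a * q) i)) (period-* f q period a i))))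

hits : ℕ → ℕ → ℕ → ℕ
hits d p n = ⟦ p ∣? n ⟧ + ⟦ p ∣? n + d ⟧

-- The function 2 - p · hits has mean zero modulo p, so that distinct squarefree
-- products of such functions are nearly orthogonal on long intervals.
balance : ℕ → ℕ → ℕ → ℤ
balance d p n = pos 2 +′ -′ pos p *′ pos (hits d p n)

-- `trunc` with the signed inner weight `balance`: the test function of the dual sieve. It equals
-- `T₂` at each sifted n, while its square is only `Φ₂` · `T₂` on average.
W : ℕ → List ℕ → ℕ → ℕ → ℤ
W d []       z n = pos (1 ⊓ z)
W d (p ∷ ps) z n = pos (p ∸ 2) *′ W d ps z n +′ balance d p n *′ W d ps (z ÷ p) n

-- The average of `W` at level y times `W` at level z. Choosing p on one side only averages to zero;
-- choosing it on both sides gives the variance 2(p - 2).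
mean : List ℕ → ℕ → ℕ → ℕ
mean []       y z = (1 ⊓ y) * (1 ⊓ z)
mean (p ∷ ps) y z = (p ∸ 2) * (p ∸ 2) * mean ps y z + 2 * (p ∸ 2) * mean ps (y ÷ p) (z ÷ p)

-- The error weight p² is one p for the size of `balance` and one p for the longer period. A prime
-- used on both sides costs only p³, rounded up to p⁴ so that the error factors as a product over
-- the two sides.
Tε : List ℕ → ℕ → ℕ
Tε = trunc (_∸ 2) (λ p → p * p)

mean-diagonal : ∀ ps z → mean ps z z ≡ Φ₂ ps * T₂ ps z
mean-diagonal [] zero = refl
mean-diagonal [] (suc z) = refl
mean-diagonal (p ∷ ps) z = trans
  (cong₂ (λ u v → (p ∸ 2) * (p ∸ 2) * u + 2 * (p ∸ 2) * v) (mean-diagonal ps z) (mean-diagonal ps (z ÷ p)))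
  (rearr (p ∸ 2) (Φ₂ ps) (T₂ ps z) (T₂ ps (z ÷ p)))
  where
  rearr : ∀ k f a b → k * k * (f * a) + 2 * k * (f * b) ≡ k * f * (k * a + 2 * b)
  rearr = solve-∀

-- Sifting primes: those for which 0 and -d are distinct residues, and p ≥ 3.
Sifting : ℕ → ℕ → Set
Sifting d p = Prime p × ¬ p ∣ 2 * d

module _ {d p} (sifting : Sifting d p) where
  private
    prime-p = proj₁ sifting

  sifting⇒3≤ : 3 ≤ p
  sifting⇒3≤ = ≤∧≢⇒< (prime⇒2≤ prime-p) λ { refl → proj₂ sifting (m∣m*n d) }

  hits≡0⊎1 : ∀ n → hits d p n ≡ 0 ⊎ hits d p n ≡ 1
  hits≡0⊎1 n with p ∣? n | p ∣? n + d
  ... | yes p∣n | yes p∣n+d = contradiction (∣n⇒∣m*n 2 (∣m+n∣m⇒∣n p∣n+d p∣n)) (proj₂ sifting)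
  ... | yes _   | no _      = inj₂ refl
  ... | no _    | yes _     = inj₂ refl
  ... | no _    | no _      = inj₁ refl

  ∣balance∣≤ : ∀ n → ∣ balance d p n ∣ ≤ p
  ∣balance∣≤ n with hits d p n | hits≡0⊎1 n
  ... | .0 | inj₁ refl rewrite ℤ.*-zeroʳ (-′ pos p) = <⇒≤ sifting⇒3≤
  ... | .1 | inj₂ refl rewrite ℤ.*-identityʳ (-′ pos p) | ℤ.m-n≡m⊖n 2 p | ℤ.∣⊖∣-≤ (<⇒≤ sifting⇒3≤) = m∸n≤m p 2

  balance² : ∀ n → balance d p n *′ balance d p n ≡ pos 4 +′ (pos p *′ pos p -′ pos 4 *′ pos p) *′ pos (hits d p n)
  balance² n with hits d p n | hits≡0⊎1 n
  ... | .0 | inj₁ refl = eq₀ (pos p)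
    where
    eq₀ : ∀ p → (pos 2 +′ -′ p *′ pos 0) *′ (pos 2 +′ -′ p *′ pos 0) ≡ pos 4 +′ (p *′ p -′ pos 4 *′ p) *′ pos 0
    eq₀ = ℤ-Solver.solve-∀
  ... | .1 | inj₂ refl = eq₁ (pos p)
    where
    eq₁ : ∀ p → (pos 2 +′ -′ p *′ pos 1) *′ (pos 2 +′ -′ p *′ pos 1) ≡ pos 4 +′ (p *′ p -′ pos 4 *′ p) *′ pos 1
    eq₁ = ℤ-Solver.solve-∀

  balance-period : ∀ n q → p ∣ q → balance d p (n + q) ≡ balance d p n
  balance-period n q p∣q = cong (λ h → pos 2 +′ -′ pos p *′ pos h) (cong₂ _+_ (∣?-period p n q p∣q)
    (trans (cong (λ m → ⟦ p ∣? m ⟧) (rearr n q d)) (∣?-period p (n + d) q p∣q)))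
    where
    rearr : ∀ n q d → n + q + d ≡ n + d + q
    rearr = solve-∀

  module _ {q} (p∤q : ¬ p ∣ q) (r : ℕ) where
    ∑-hits : ∑ p (λ i → hits d p (r + i * q)) ≡ 2
    ∑-hits = trans (∑-+ p _ _) (cong₂ _+_ (count-solutions prime-p p∤q r)
      (trans (∑-cong p λ i → cong (λ m → ⟦ p ∣? m ⟧) (rearr r (i * q) d)) (count-solutions prime-p p∤q (r + d))))
      where
      rearr : ∀ r k d → r + k + d ≡ r + d + k
      rearr = solve-∀

    ∑-balance : ∑ℤ p (λ i → balance d p (r + i * q)) ≡ pos 0
    ∑-balance = trans (∑ℤ-affine p (pos 2) (-′ pos p) _)
      (trans (cong (λ h → pos p *′ pos 2 +′ -′ pos p *′ pos h) ∑-hits) (zero-eq (pos p)))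
      where
      zero-eq : ∀ p → p *′ pos 2 +′ -′ p *′ pos 2 ≡ pos 0
      zero-eq = ℤ-Solver.solve-∀

    ∑-balance² : ∑ℤ p (λ i → balance d p (r + i * q) *′ balance d p (r + i * q)) ≡ pos 2 *′ pos p *′ pos (p ∸ 2)
    ∑-balance² = trans (Sumℤ.∑-cong p λ i → balance² (r + i * q))
      (trans (∑ℤ-affine p (pos 4) (pos p *′ pos p -′ pos 4 *′ pos p) (λ i → hits d p (r + i * q)))
      (trans (cong (λ h → pos p *′ pos 4 +′ (pos p *′ pos p -′ pos 4 *′ pos p) *′ pos h) ∑-hits)
      (eq (pos p) (pos (p ∸ 2)) (cong pos (sym (m+[n∸m]≡n (<⇒≤ sifting⇒3≤)))))))
      where
      eq′ : ∀ k → (pos 2 +′ k) *′ pos 4 +′ ((pos 2 +′ k) *′ (pos 2 +′ k) -′ pos 4 *′ (pos 2 +′ k)) *′ pos 2 ≡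
        pos 2 *′ (pos 2 +′ k) *′ k
      eq′ = ℤ-Solver.solve-∀
      eq : ∀ p k → p ≡ pos 2 +′ k → p *′ pos 4 +′ (p *′ p -′ pos 4 *′ p) *′ pos 2 ≡ pos 2 *′ p *′ k
      eq .(pos 2 +′ k) k refl = eq′ k

∣+₄∣≤ : ∀ a b c d → ∣ a +′ b +′ c +′ d ∣ ≤ ∣ a ∣ + ∣ b ∣ + ∣ c ∣ + ∣ d ∣
∣+₄∣≤ a b c d = ≤-trans (ℤ.∣i+j∣≤∣i∣+∣j∣ (a +′ b +′ c) d) (+-monoˡ-≤ ∣ d ∣
  (≤-trans (ℤ.∣i+j∣≤∣i∣+∣j∣ (a +′ b) c) (+-monoˡ-≤ ∣ c ∣ (ℤ.∣i+j∣≤∣i∣+∣j∣ a b))))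

-- The algebra of one induction step of `sieve-form`. The terms with m₂ and m₃ are the mixed ones;
-- they are inserted for free because s₁ is zero.
form-identity : ∀ p q k N s x₁ x₂ x₃ x₄ m₁ m₂ m₃ m₄ {x m s₁ s₂ pkk pq} →
  x ≡ k *′ k *′ x₁ +′ k *′ x₂ +′ k *′ x₃ +′ x₄ → m ≡ k *′ k *′ m₁ +′ pos 2 *′ k *′ m₄ →
  s₁ ≡ s *′ pos 0 → s₂ ≡ s *′ (pos 2 *′ p *′ k) → pkk ≡ p *′ (k *′ k) → pq ≡ p *′ q →
  p *′ (q *′ x -′ N *′ (s *′ m)) ≡
    pkk *′ (q *′ x₁ -′ N *′ (s *′ m₁)) +′ k *′ (pq *′ x₂ -′ N *′ (s₁ *′ m₂))
      +′ k *′ (pq *′ x₃ -′ N *′ (s₁ *′ m₃)) +′ (pq *′ x₄ -′ N *′ (s₂ *′ m₄))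
form-identity p q k N s x₁ x₂ x₃ x₄ m₁ m₂ m₃ m₄ refl refl refl refl refl refl =
  identity p q k N s x₁ x₂ x₃ x₄ m₁ m₂ m₃ m₄
  where
  identity : ∀ p q k N s x₁ x₂ x₃ x₄ m₁ m₂ m₃ m₄ →
    p *′ (q *′ (k *′ k *′ x₁ +′ k *′ x₂ +′ k *′ x₃ +′ x₄) -′ N *′ (s *′ (k *′ k *′ m₁ +′ pos 2 *′ k *′ m₄))) ≡
    p *′ (k *′ k) *′ (q *′ x₁ -′ N *′ (s *′ m₁)) +′ k *′ (p *′ q *′ x₂ -′ N *′ (s *′ pos 0 *′ m₂))
      +′ k *′ (p *′ q *′ x₃ -′ N *′ (s *′ pos 0 *′ m₃)) +′ (p *′ q *′ x₄ -′ N *′ (s *′ (pos 2 *′ p *′ k) *′ m₄))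
  identity = ℤ-Solver.solve-∀

-- Near orthogonality. The general weight `f` lets the induction absorb `balance` or its square, at
-- the cost of period p·q and bound F·p or F·p². The levels y and z are independent because a mixed
-- term lowers only one of them. The sieve uses f = 1, q = 1 and y = z.
sieve-form : ∀ {d} N ps → Unique ps → All (Sifting d) ps →
  ∀ f q .{{_ : NonZero q}} F → (∀ n → f (n + q) ≡ f n) → (∀ n → ∣ f n ∣ ≤ F) → All (λ p → ¬ p ∣ q) ps → ∀ y z →
  ∣ pos q *′ ∑ℤ N (λ n → f n *′ (W d ps y n *′ W d ps z n)) -′ pos N *′ (∑ℤ q f *′ pos (mean ps y z)) ∣
    ≤ q * (2 * (Tε ps y * Tε ps z) * (q * F))
sieve-form N [] [] [] f q F period bound [] y z = begin
  ∣ pos q *′ ∑ℤ N (λ n → f n *′ (pos u *′ pos v)) -′ pos N *′ (∑ℤ q f *′ pos (u * v)) ∣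
    ≡⟨ cong₂ (λ a b → ∣ pos q *′ a -′ pos N *′ (∑ℤ q f *′ b) ∣) (Sumℤ.∑-*ʳ N (pos u *′ pos v) f) (ℤ.pos-* u v) ⟩
  ∣ pos q *′ (∑ℤ N f *′ (pos u *′ pos v)) -′ pos N *′ (∑ℤ q f *′ (pos u *′ pos v)) ∣
    ≡⟨ cong ∣_∣ (rearr₁ (pos q) (∑ℤ N f) (pos u *′ pos v) (pos N) (∑ℤ q f)) ⟩
  ∣ (pos q *′ ∑ℤ N f -′ pos N *′ ∑ℤ q f) *′ (pos u *′ pos v) ∣
    ≡⟨ trans (ℤ.abs-* (pos q *′ ∑ℤ N f -′ pos N *′ ∑ℤ q f) _)
         (cong (∣ pos q *′ ∑ℤ N f -′ pos N *′ ∑ℤ q f ∣ *_) (ℤ.abs-* (pos u) (pos v))) ⟩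
  ∣ pos q *′ ∑ℤ N f -′ pos N *′ ∑ℤ q f ∣ * (u * v)
    ≤⟨ *-monoˡ-≤ (u * v) (periodic-sum N f q F period bound) ⟩
  q * (2 * (q * F)) * (u * v)
    ≡⟨ rearr₂ q (q * F) (u * v) ⟩
  q * (2 * (u * v) * (q * F)) ∎
  where
  u = 1 ⊓ y
  v = 1 ⊓ z
  rearr₁ : ∀ q a c n s → q *′ (a *′ c) -′ n *′ (s *′ c) ≡ (q *′ a -′ n *′ s) *′ c
  rearr₁ = ℤ-Solver.solve-∀
  rearr₂ : ∀ q a c → q * (2 * a) * c ≡ q * (2 * c * a)
  rearr₂ = solve-∀
sieve-form {d} N (p ∷ ps) (p∉ps ∷ uniq) (sifting ∷ siftings) f q F period bound (p∤q ∷ ps∤q) y z =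
  -- Terms containing `balance` are controlled with period p·q, so the claim for period q is first
  -- multiplied by p.
  *-cancelˡ-≤ p {{prime⇒nonZero prime-p}} (begin
    p * ∣ pos q *′ X -′ pos N *′ (s *′ pos (mean (p ∷ ps) y z)) ∣
      ≡⟨ ℤ.abs-* (pos p) _ ⟨
    ∣ pos p *′ (pos q *′ X -′ pos N *′ (s *′ pos (mean (p ∷ ps) y z))) ∣
      ≡⟨ cong ∣_∣ decompose ⟩
    ∣ pos (p * (k * k)) *′ Δ₁ +′ pos k *′ Δ₂ +′ pos k *′ Δ₃ +′ Δ₄ ∣
      ≤⟨ ∣+₄∣≤ (pos (p * (k * k)) *′ Δ₁) (pos k *′ Δ₂) (pos k *′ Δ₃) Δ₄ ⟩
    ∣ pos (p * (k * k)) *′ Δ₁ ∣ + ∣ pos k *′ Δ₂ ∣ + ∣ pos k *′ Δ₃ ∣ + ∣ Δ₄ ∣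
      ≡⟨ cong (_+ ∣ Δ₄ ∣) (cong₂ _+_ (cong₂ _+_ (ℤ.abs-* (pos (p * (k * k))) Δ₁) (ℤ.abs-* (pos k) Δ₂)) (ℤ.abs-* (pos k) Δ₃)) ⟩
    p * (k * k) * ∣ Δ₁ ∣ + k * ∣ Δ₂ ∣ + k * ∣ Δ₃ ∣ + ∣ Δ₄ ∣
      ≤⟨ +-mono-≤ (+-mono-≤ (+-mono-≤
           (*-monoʳ-≤ (p * (k * k)) (sieve-form N ps uniq siftings f q F period bound ps∤q y z))
           (*-monoʳ-≤ k (step f₁ (F * p) period₁ bound₁ y′ z)))
           (*-monoʳ-≤ k (step f₁ (F * p) period₁ bound₁ y z′)))
           (step f₂ (F * (p * p)) period₂ bound₂ y′ z′) ⟩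
    p * (k * k) * (q * (2 * (a * b) * (q * F))) + k * (pq * (2 * (a′ * b) * (pq * (F * p))))
      + k * (pq * (2 * (a * b′) * (pq * (F * p)))) + pq * (2 * (a′ * b′) * (pq * (F * (p * p))))
      ≡⟨ factor p k q F (a) (b) (a′) (b′) ⟩
    p * (q * (2 * (k * k * (a * b) + k * (p * p) * (a′ * b + a * b′) + p * (p * p) * (a′ * b′)) * (q * F)))
      ≤⟨ *-monoʳ-≤ p (*-monoʳ-≤ q (*-monoˡ-≤ (q * F) (*-monoʳ-≤ 2 (+-monoʳ-≤ (k * k * (a * b) + k * (p * p) * (a′ * b + a * b′))
           (*-monoˡ-≤ (a′ * b′) (*-monoˡ-≤ (p * p) (m≤m*n p p {{prime⇒nonZero prime-p}}))))))) ⟩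
    p * (q * (2 * (k * k * (a * b) + k * (p * p) * (a′ * b + a * b′) + p * p * (p * p) * (a′ * b′)) * (q * F)))
      ≡⟨ unfactor p k q F (a) (b) (a′) (b′) ⟩
    p * (q * (2 * (Tε (p ∷ ps) y * Tε (p ∷ ps) z) * (q * F))) ∎)
  where
  prime-p = proj₁ sifting
  k = p ∸ 2
  y′ = y ÷ p
  z′ = z ÷ p
  a = Tε ps y
  b = Tε ps z
  a′ = Tε ps y′
  b′ = Tε ps z′
  pq = p * q
  s = ∑ℤ q f
  h = balance d p
  f₁ f₂ : ℕ → ℤ
  f₁ n = f n *′ h n
  f₂ n = f n *′ (h n *′ h n)
  form : (ℕ → ℤ) → ℕ → ℕ → ℤ
  form f y z = ∑ℤ N (λ n → f n *′ (W d ps y n *′ W d ps z n))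
  X = ∑ℤ N (λ n → f n *′ (W d (p ∷ ps) y n *′ W d (p ∷ ps) z n))
  Δ₁ = pos q *′ form f y z -′ pos N *′ (s *′ pos (mean ps y z))
  Δ : (ℕ → ℤ) → ℕ → ℕ → ℤ
  Δ g y z = pos pq *′ form g y z -′ pos N *′ (∑ℤ pq g *′ pos (mean ps y z))
  Δ₂ = Δ f₁ y′ z
  Δ₃ = Δ f₁ y z′
  Δ₄ = Δ f₂ y′ z′
  instance
    pq≢0 : NonZero pq
    pq≢0 = m*n≢0 p q {{prime⇒nonZero prime-p}}
  period-pq : ∀ n → f (n + pq) ≡ f n
  period-pq = period-* f q period p
  period₁ : ∀ n → f₁ (n + pq) ≡ f₁ n
  period₁ n = cong₂ _*′_ (period-pq n) (balance-period sifting n pq (m∣m*n q))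
  period₂ : ∀ n → f₂ (n + pq) ≡ f₂ n
  period₂ n = cong₂ (λ a b → a *′ (b *′ b)) (period-pq n) (balance-period sifting n pq (m∣m*n q))
  bound₁ : ∀ n → ∣ f₁ n ∣ ≤ F * p
  bound₁ n = ≤-trans (≤-reflexive (ℤ.abs-* (f n) (h n))) (*-mono-≤ (bound n) (∣balance∣≤ sifting n))
  bound₂ : ∀ n → ∣ f₂ n ∣ ≤ F * (p * p)
  bound₂ n = ≤-trans (≤-reflexive (trans (ℤ.abs-* (f n) (h n *′ h n)) (cong (∣ f n ∣ *_) (ℤ.abs-* (h n) (h n)))))
    (*-mono-≤ (bound n) (*-mono-≤ (∣balance∣≤ sifting n) (∣balance∣≤ sifting n)))
  ps∤pq : ∀ {ps} → All (p ≢_) ps → All (Sifting d) ps → All (λ p → ¬ p ∣ q) ps → All (λ p′ → ¬ p′ ∣ pq) ps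
  ps∤pq [] [] [] = []
  ps∤pq (p≢p′ ∷ p≢) (sp′ ∷ sp) (p′∤q ∷ ∤q) =
    (λ p′∣pq → [ (λ p′∣p → p≢p′ (sym (prime∣prime⇒≡ (proj₁ sp′) prime-p p′∣p))) , p′∤q ]′ (euclidsLemma p q (proj₁ sp′) p′∣pq))
    ∷ ps∤pq p≢ sp ∤q
  step : ∀ g G → (∀ n → g (n + pq) ≡ g n) → (∀ n → ∣ g n ∣ ≤ G) → ∀ y z → ∣ Δ g y z ∣ ≤ pq * (2 * (Tε ps y * Tε ps z) * (pq * G))
  step g G per bd = sieve-form N ps uniq siftings g pq G per bd (ps∤pq p∉ps siftings ps∤q)
  sum₁ : ∑ℤ pq f₁ ≡ s *′ pos 0
  sum₁ = Sumℤ.∑-crt p q f h (pos 0) period (∑-balance sifting p∤q)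
  sum₂ : ∑ℤ pq f₂ ≡ s *′ (pos 2 *′ pos p *′ pos k)
  sum₂ = Sumℤ.∑-crt p q f (λ n → h n *′ h n) _ period (∑-balance² sifting p∤q)
  expand : X ≡ pos k *′ pos k *′ form f y z +′ pos k *′ form f₁ y′ z +′ pos k *′ form f₁ y z′ +′ form f₂ y′ z′
  expand = trans (Sumℤ.∑-cong N λ n → multiply (pos k) (f n) (h n) (W d ps y n) (W d ps z n) (W d ps y′ n) (W d ps z′ n))
    (trans (Sumℤ.∑-+ N _ _) (cong (_+′ form f₂ y′ z′)
    (trans (Sumℤ.∑-+ N _ _) (cong₂ _+′_
    (trans (Sumℤ.∑-+ N _ _) (cong₂ _+′_ (Sumℤ.∑-*ˡ N (pos k *′ pos k) _) (Sumℤ.∑-*ˡ N (pos k) _)))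
    (Sumℤ.∑-*ˡ N (pos k) _)))))
    where
    multiply : ∀ k f h a b a′ b′ → f *′ ((k *′ a +′ h *′ a′) *′ (k *′ b +′ h *′ b′)) ≡
      k *′ k *′ (f *′ (a *′ b)) +′ k *′ (f *′ h *′ (a′ *′ b)) +′ k *′ (f *′ h *′ (a *′ b′)) +′ f *′ (h *′ h) *′ (a′ *′ b′)
    multiply = ℤ-Solver.solve-∀
  pos-mean : pos (mean (p ∷ ps) y z) ≡ pos k *′ pos k *′ pos (mean ps y z) +′ pos 2 *′ pos k *′ pos (mean ps y′ z′)
  pos-mean = cong₂ _+′_ (trans (ℤ.pos-* (k * k) _) (cong (_*′ pos (mean ps y z)) (ℤ.pos-* k k)))
    (trans (ℤ.pos-* (2 * k) _) (cong (_*′ pos (mean ps y′ z′)) (ℤ.pos-* 2 k)))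
  decompose : pos p *′ (pos q *′ X -′ pos N *′ (s *′ pos (mean (p ∷ ps) y z))) ≡
    pos (p * (k * k)) *′ Δ₁ +′ pos k *′ Δ₂ +′ pos k *′ Δ₃ +′ Δ₄
  decompose = form-identity (pos p) (pos q) (pos k) (pos N) s (form f y z) (form f₁ y′ z) (form f₁ y z′) (form f₂ y′ z′)
    (pos (mean ps y z)) (pos (mean ps y′ z)) (pos (mean ps y z′)) (pos (mean ps y′ z′))
    expand pos-mean sum₁ sum₂ (trans (ℤ.pos-* p (k * k)) (cong (pos p *′_) (ℤ.pos-* k k))) (ℤ.pos-* p q)
  factor : ∀ p k q F a b a′ b′ → p * (k * k) * (q * (2 * (a * b) * (q * F))) + k * (p * q * (2 * (a′ * b) * (p * q * (F * p))))
      + k * (p * q * (2 * (a * b′) * (p * q * (F * p)))) + p * q * (2 * (a′ * b′) * (p * q * (F * (p * p)))) ≡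
    p * (q * (2 * (k * k * (a * b) + k * (p * p) * (a′ * b + a * b′) + p * (p * p) * (a′ * b′)) * (q * F)))
  factor = solve-∀
  unfactor : ∀ p k q F a b a′ b′ →
    p * (q * (2 * (k * k * (a * b) + k * (p * p) * (a′ * b + a * b′) + p * p * (p * p) * (a′ * b′)) * (q * F))) ≡
    p * (q * (2 * ((k * a + p * p * a′) * (k * b + p * p * b′)) * (q * F)))
  unfactor = solve-∀

sievers-Sifting : ∀ d n → All (Sifting d) (sievers d n)
sievers-Sifting d n = All.zip (filter⁺ _ (all-filter prime? (downFrom (suc n))) , all-filter _ (primes≤ n))

sievers-Unique : ∀ d n → Unique (sievers d n)
sievers-Unique d n = Unique.filter⁺ _ (Unique.filter⁺ prime? (Unique.downFrom⁺ (suc n)))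

sievers-≤ : ∀ d n {p} → p ∈ sievers d n → Prime p × p ≤ n
sievers-≤ d n p∈ with p∈primes , _ ← ∈-filter⁻ (¬? ∘ (_∣? 2 * d)) p∈
  with p∈down , prime-p ← ∈-filter⁻ prime? p∈primes = prime-p , s≤s⁻¹ (∈-downFrom⁻ p∈down)

-- Origin of the fourth power: with w = ⌊z/n⌋, a new prime n adds n²(n+1)w⁴ ≤ (nw)⁴ ≤ z⁴ relative to
-- `Φ₂`, where n² is the error weight and n + 1 ≤ n² bounds the factor already accumulated. So each
-- n adds at most one z⁴.
Tε-bound : ∀ d n z → Tε (filter (¬? ∘ (_∣? 2 * d)) (filter prime? (downFrom n))) z ≤
  Φ₂ (filter (¬? ∘ (_∣? 2 * d)) (filter prime? (downFrom n))) * (suc n * (z * z * (z * z)))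
Tε-bound d zero zero = z≤n
Tε-bound d zero (suc z) = s≤s z≤n
Tε-bound d (suc n) z = by-cases
  where
  ps = filter (¬? ∘ (_∣? 2 * d)) (filter prime? (downFrom n))
  z⁴ = z * z * (z * z)
  skip : Tε ps z ≤ Φ₂ ps * (suc (suc n) * z⁴)
  skip = ≤-trans (Tε-bound d n z) (*-monoʳ-≤ (Φ₂ ps) (m≤n+m (suc n * z⁴) z⁴))
  keep : Sifting d n → Tε (n ∷ ps) z ≤ Φ₂ (n ∷ ps) * (suc (suc n) * z⁴)
  keep sifting = begin
    k * Tε ps z + n * n * Tε ps w
      ≤⟨ +-mono-≤ (*-monoʳ-≤ k (Tε-bound d n z)) (*-monoʳ-≤ (n * n) (Tε-bound d n w)) ⟩
    k * (f * (suc n * z⁴)) + n * n * (f * (suc n * (w * w * (w * w))))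
      ≡⟨ cong (k * (f * (suc n * z⁴)) +_) (rearr₁ n f (suc n) w) ⟩
    k * (f * (suc n * z⁴)) + f * (suc n * (n * w * (n * w) * (w * w)))
      ≤⟨ +-monoʳ-≤ (k * (f * (suc n * z⁴))) (*-monoʳ-≤ f (*-monoˡ-≤ (n * w * (n * w) * (w * w)) suc-n≤n*n)) ⟩
    k * (f * (suc n * z⁴)) + f * (n * n * (n * w * (n * w) * (w * w)))
      ≡⟨ cong (λ e → k * (f * (suc n * z⁴)) + f * e) (rearr₂ n w) ⟩
    k * (f * (suc n * z⁴)) + f * (n * w * (n * w) * (n * w * (n * w)))
      ≤⟨ +-monoʳ-≤ (k * (f * (suc n * z⁴))) (*-monoʳ-≤ f (*-mono-≤ (*-mono-≤ nw≤z nw≤z) (*-mono-≤ nw≤z nw≤z))) ⟩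
    k * (f * (suc n * z⁴)) + f * z⁴
      ≤⟨ +-monoʳ-≤ (k * (f * (suc n * z⁴))) (*-monoˡ-≤ z⁴ (m≤n*m f k {{>-nonZero 1≤k}})) ⟩
    k * (f * (suc n * z⁴)) + k * f * z⁴
      ≡⟨ rearr₃ k f n z⁴ ⟩
    k * f * (suc (suc n) * z⁴) ∎
    where
    w = z ÷ n
    k = n ∸ 2
    f = Φ₂ ps
    nw≤z : n * w ≤ z
    nw≤z = *÷≤ z n
    1≤k : 1 ≤ k
    1≤k = m<n⇒0<n∸m (sifting⇒3≤ {d} sifting)
    suc-n≤n*n : suc n ≤ n * n
    suc-n≤n*n = begin
      suc n  ≤⟨ +-monoˡ-≤ n (<⇒≤ (<⇒≤ (sifting⇒3≤ {d} sifting))) ⟩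
      n + n  ≡⟨ cong (n +_) (+-identityʳ n) ⟨
      2 * n  ≤⟨ *-monoˡ-≤ n (<⇒≤ (sifting⇒3≤ {d} sifting)) ⟩
      n * n  ∎
    rearr₁ : ∀ n f m w → n * n * (f * (m * (w * w * (w * w)))) ≡ f * (m * (n * w * (n * w) * (w * w)))
    rearr₁ = solve-∀
    rearr₂ : ∀ n w → n * n * (n * w * (n * w) * (w * w)) ≡ n * w * (n * w) * (n * w * (n * w))
    rearr₂ = solve-∀
    rearr₃ : ∀ k f n z → k * (f * (suc n * z)) + k * f * z ≡ k * f * (suc (suc n) * z)
    rearr₃ = solve-∀
  by-cases : Tε (filter (¬? ∘ (_∣? 2 * d)) (filter prime? (n ∷ downFrom n))) z ≤
    Φ₂ (filter (¬? ∘ (_∣? 2 * d)) (filter prime? (n ∷ downFrom n))) * (suc (suc n) * z⁴)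
  by-cases with prime? n
  ... | no _ = skip
  ... | yes prime-n with n ∣? 2 * d
  ...   | yes _ = skip
  ...   | no n∤ = keep (prime-n , n∤)

siftPair : ℕ → List ℕ → ℕ → ℕ
siftPair d ps n = sift ps n * sift ps (n + d)

-- At a sifted n all `hits` vanish, and `balance` is 2, the inner weight of `T₂`.
W-sifted : ∀ d ps n → siftPair d ps n ≡ 0 ⊎ (∀ z → W d ps z n ≡ pos (T₂ ps z))
W-sifted d []       n = inj₂ λ z → refl
W-sifted d (p ∷ ps) n with p ∣? n | p ∣? n + d
... | yes _ | _     = inj₁ refl
... | no _  | yes _ = inj₁ (*-zeroʳ (1 * sift ps n))
... | no _  | no _  with W-sifted d ps n
...   | inj₁ eq = inj₁ (trans (cong₂ _*_ (+-identityʳ (sift ps n)) (+-identityʳ (sift ps (n + d)))) eq)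
...   | inj₂ eq = inj₂ λ z → trans
  (cong₂ (λ a b → pos (p ∸ 2) *′ a +′ (pos 2 +′ -′ pos p *′ pos 0) *′ b) (eq z) (eq (z ÷ p)))
  (cong₂ _+′_ (sym (ℤ.pos-* (p ∸ 2) _)) (trans (drop (pos p) (pos (T₂ ps (z ÷ p)))) (sym (ℤ.pos-* 2 (T₂ ps (z ÷ p))))))
  where
  drop : ∀ p t → (pos 2 +′ -′ p *′ pos 0) *′ t ≡ pos 2 *′ t
  drop = ℤ-Solver.solve-∀

square-pos : ∀ i → i *′ i ≡ pos (∣ i ∣ * ∣ i ∣)
square-pos (pos n)      = sym (ℤ.pos-* n n)
square-pos ℤ.-[1+ n ] = refl

Φ₂≤T₂ : ∀ ps z → 1 ≤ z → Φ₂ ps ≤ T₂ ps z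
Φ₂≤T₂ []       (suc z) _   = ≤-refl
Φ₂≤T₂ (p ∷ ps) z       1≤z = ≤-trans (*-monoʳ-≤ (p ∸ 2) (Φ₂≤T₂ ps z 1≤z)) (m≤m+n _ _)

-- Bessel's inequality: `W` is T at every sifted point, so the number of these times T² is at most
-- the sum of the squares of `W`, which is N·f·T up to the error. One factor T is then cancelled.
sieve-bound : ∀ d n N z → 1 ≤ z → let B = suc (suc n) * (z * z * (z * z)) in
  ∑ N (siftPair d (sievers d n)) * T₂ (sievers d n) z ≤ Φ₂ (sievers d n) * (N + 2 * (B * B))
sieve-bound d n N z 1≤z = *-cancelʳ-≤ (∑ N A * T) (f * (N + 2 * (B * B))) T {{>-nonZero T>0}} (begin
  ∑ N A * T * T
    ≡⟨ *-assoc (∑ N A) T T ⟩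
  ∑ N A * (T * T)
    ≡⟨ ∑-*ʳ N (T * T) A ⟨
  ∑ N (λ m → A m * (T * T))
    ≤⟨ ∑-mono N pointwise ⟩
  S
    ≤⟨ S-bound ⟩
  N * (f * T) + 2 * (Tε ps z * Tε ps z)
    ≤⟨ +-monoʳ-≤ (N * (f * T)) (*-monoʳ-≤ 2 (*-mono-≤ (Tε-bound d (suc n) z) (Tε-bound d (suc n) z))) ⟩
  N * (f * T) + 2 * (f * B * (f * B))
    ≡⟨ cong (λ e → N * (f * T) + 2 * e) (rearr₁ f B) ⟩
  N * (f * T) + 2 * (f * f * (B * B))
    -- Trading one f for T gives the error term the factor T that is to be cancelled.
    ≤⟨ +-monoʳ-≤ (N * (f * T)) (*-monoʳ-≤ 2 (*-monoˡ-≤ (B * B) (*-monoʳ-≤ f f≤T))) ⟩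
  N * (f * T) + 2 * (f * T * (B * B))
    ≡⟨ rearr₂ N f T (B * B) ⟩
  f * (N + 2 * (B * B)) * T ∎)
  where
  ps = sievers d n
  T = T₂ ps z
  f = Φ₂ ps
  B = suc (suc n) * (z * z * (z * z))
  A = siftPair d ps
  sq : ℕ → ℕ
  sq m = ∣ W d ps z m ∣ * ∣ W d ps z m ∣
  S = ∑ N sq
  f≤T : f ≤ T
  f≤T = Φ₂≤T₂ ps z 1≤z
  T>0 : 1 ≤ T
  T>0 = ≤-trans (prod-pos (_∸ 2) (All.map (λ sifting → m<n⇒0<n∸m (sifting⇒3≤ {d} sifting)) (sievers-Sifting d n))) f≤T
  rearr₁ : ∀ f b → f * b * (f * b) ≡ f * f * (b * b)
  rearr₁ = solve-∀
  rearr₂ : ∀ n f t b → n * (f * t) + 2 * (f * t * b) ≡ f * (n + 2 * b) * t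
  rearr₂ = solve-∀
  pointwise : ∀ m → A m * (T * T) ≤ sq m
  pointwise m with W-sifted d ps m
  ... | inj₁ eq = ≤-trans (≤-reflexive (cong (_* (T * T)) eq)) z≤n
  ... | inj₂ eq = ≤-trans (*-monoˡ-≤ (T * T) (*-mono-≤ (sift≤1 ps m) (sift≤1 ps (m + d))))
    (≤-reflexive (trans (+-identityʳ (T * T)) (cong (λ w → ∣ w ∣ * ∣ w ∣) (sym (eq z)))))
  form≡S : ∑ℤ N (λ m → pos 1 *′ (W d ps z m *′ W d ps z m)) ≡ pos S
  form≡S = trans (Sumℤ.∑-cong N λ m → trans (ℤ.*-identityˡ _) (square-pos (W d ps z m))) (∑ℤ-pos N sq)
  unit : ∑ℤ 1 (λ _ → pos 1) ≡ pos 1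
  unit = trans (∑ℤ-pos 1 (λ _ → 1)) (cong pos (∑-const 1 1))
  K = N * (f * T)
  E = 2 * (Tε ps z * Tε ps z)
  close : ∣ pos S -′ pos K ∣ ≤ E
  close = begin
    ∣ pos S -′ pos K ∣
      ≡⟨ cong₂ (λ u v → ∣ u -′ v ∣) (sym (trans (ℤ.*-identityˡ _) form≡S)) (sym main) ⟩
    ∣ pos 1 *′ ∑ℤ N (λ m → pos 1 *′ (W d ps z m *′ W d ps z m)) -′ pos N *′ (∑ℤ 1 (λ _ → pos 1) *′ pos (mean ps z z)) ∣
      ≤⟨ sieve-form N ps (sievers-Unique d n) (sievers-Sifting d n) (λ _ → pos 1) 1 1 (λ _ → refl) (λ _ → ≤-refl)
           (All.map (λ (prime-p , _) p∣1 → <⇒≱ (prime⇒2≤ prime-p) (∣⇒≤ p∣1)) (sievers-Sifting d n)) z z ⟩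
    1 * (E * 1)
      ≡⟨ trans (+-identityʳ _) (*-identityʳ E) ⟩
    E ∎
    where
    main : pos N *′ (∑ℤ 1 (λ _ → pos 1) *′ pos (mean ps z z)) ≡ pos K
    main = trans (cong (pos N *′_) (trans (cong₂ _*′_ unit (cong pos (mean-diagonal ps z))) (ℤ.*-identityˡ _)))
      (sym (ℤ.pos-* N (f * T)))
  S-bound : S ≤ K + E
  S-bound = begin
    ∣ pos S ∣                        ≡⟨ cong ∣_∣ (cancel (pos S) (pos K)) ⟩
    ∣ pos K +′ (pos S -′ pos K) ∣    ≤⟨ ℤ.∣i+j∣≤∣i∣+∣j∣ (pos K) (pos S -′ pos K) ⟩
    K + ∣ pos S -′ pos K ∣           ≤⟨ +-monoʳ-≤ K close ⟩
    K + E                            ∎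
    where
    cancel : ∀ a b → a ≡ b +′ (a -′ b)
    cancel = ℤ-Solver.solve-∀

-- Prime pairs survive the sieve

sift-one : ∀ {qs m} → All (λ q → ¬ q ∣ m) qs → sift qs m ≡ 1
sift-one []                           = refl
sift-one {q ∷ qs} {m} (q∤m ∷ qs∤m) = cong₂ _*_ (⟦⟧-yes (¬? (q ∣? m)) q∤m) (sift-one qs∤m)

∑≤? : ∀ N n → ∑ N (λ m → ⟦ m ≤? n ⟧) ≤ suc n
∑≤? N n = begin
  ∑ N (λ m → ⟦ m ≤? n ⟧)        ≤⟨ ∑-trim (suc n) N (λ m n<m → ⟦⟧-no (m ≤? n) (<⇒≱ n<m)) ⟩
  ∑ (suc n) (λ m → ⟦ m ≤? n ⟧)  ≤⟨ ∑-mono (suc n) (λ m → ⟦⟧≤1 (m ≤? n)) ⟩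
  ∑ (suc n) (λ _ → 1)           ≡⟨ trans (∑-const (suc n) 1) (*-identityʳ (suc n)) ⟩
  suc n                         ∎

-- A prime beyond n is divisible by no sieving prime; pairs with smaller member at most n are
-- counted trivially.
G≤sifted : ∀ x d n → G x d ≤ ∑ (suc x) (siftPair d (sievers d n)) + suc n
G≤sifted x d n = begin
  G x d
    ≡⟨ length-filter-applyUpTo Q? id (suc x) ⟩
  ∑ (suc x) (λ p → ⟦ Q? p ⟧)
    ≤⟨ ∑-mono (suc x) pointwise ⟩
  ∑ (suc x) (λ p → siftPair d ps p + ⟦ p ≤? n ⟧)
    ≡⟨ ∑-+ (suc x) _ _ ⟩
  ∑ (suc x) (siftPair d ps) + ∑ (suc x) (λ p → ⟦ p ≤? n ⟧)
    ≤⟨ +-monoʳ-≤ _ (∑≤? (suc x) n) ⟩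
  ∑ (suc x) (siftPair d ps) + suc n ∎
  where
  ps = sievers d n
  Q? : ∀ p → Dec (Prime p × (Prime (p + d) × p + d ≤ x))
  Q? p = prime? p ×-dec (prime? (p + d) ×-dec (p + d ≤? x))
  coprime : ∀ {m} → Prime m → n < m → sift ps m ≡ 1
  coprime prime-m n<m = sift-one (All.tabulate λ q∈ q∣m →
    let prime-q , q≤n = sievers-≤ d n q∈ in
    <⇒≢ (≤-<-trans q≤n n<m) (prime∣prime⇒≡ prime-q prime-m q∣m))
  pointwise : ∀ p → ⟦ Q? p ⟧ ≤ siftPair d ps p + ⟦ p ≤? n ⟧
  pointwise p = by-cases (Q? p) (p ≤? n)
    where
    by-cases : ∀ {R : Set} (q : Dec (Prime p × (Prime (p + d) × R))) (l : Dec (p ≤ n)) → ⟦ q ⟧ ≤ siftPair d ps p + ⟦ l ⟧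
    by-cases (no _) _ = z≤n
    by-cases (yes _) (yes _) = m≤n+m 1 (siftPair d ps p)
    by-cases (yes (prime-p , prime-p+d , _)) (no p≰n) = ≤-trans
      (≤-reflexive (sym (cong₂ _*_ (coprime prime-p (≰⇒> p≰n)) (coprime prime-p+d (<-≤-trans (≰⇒> p≰n) (m≤m+n p d))))))
      (m≤m+n (siftPair d ps p) 0)

G-upper : ∀ d .{{_ : NonZero d}} M x s → ω d < M → let z = 2 ^ s * 2 ^ s; B = suc (suc (2 ^ s)) * (z * z * (z * z)) in
  G x d * (s * s) ≤ 4 ^ suc M * (suc x + 2 * (B * B)) + suc (2 ^ s) * (s * s)
G-upper d M x s ω<M = begin
  G x d * (s * s)
    ≤⟨ *-monoˡ-≤ (s * s) (G≤sifted x d (2 ^ s)) ⟩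
  (A + suc (2 ^ s)) * (s * s)
    ≡⟨ *-distribʳ-+ (s * s) A (suc (2 ^ s)) ⟩
  A * (s * s) + suc (2 ^ s) * (s * s)
    ≤⟨ +-monoˡ-≤ (suc (2 ^ s) * (s * s)) sifted ⟩
  4 ^ suc M * (suc x + 2 * (B * B)) + suc (2 ^ s) * (s * s) ∎
  where
  z = 2 ^ s * 2 ^ s
  B = suc (suc (2 ^ s)) * (z * z * (z * z))
  ps = sievers d (2 ^ s)
  A = ∑ (suc x) (siftPair d ps)
  R = suc x + 2 * (B * B)
  f>0 : 1 ≤ Φ₂ ps
  f>0 = prod-pos (_∸ 2) (All.map (λ sifting → m<n⇒0<n∸m (sifting⇒3≤ {d} sifting)) (sievers-Sifting d (2 ^ s)))
  rearr₁ : ∀ f a s → f * (a * (s * s)) ≡ a * (s * s * f)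
  rearr₁ = solve-∀
  rearr₂ : ∀ a c t → a * (c * t) ≡ c * (a * t)
  rearr₂ = solve-∀
  sifted : A * (s * s) ≤ 4 ^ suc M * R
  sifted = *-cancelˡ-≤ (Φ₂ ps) {{>-nonZero f>0}} (begin
    Φ₂ ps * (A * (s * s))              ≡⟨ rearr₁ (Φ₂ ps) A s ⟩
    A * (s * s * Φ₂ ps)                ≤⟨ *-monoʳ-≤ A (T₂-lower d s M ω<M) ⟩
    A * (4 ^ suc M * T₂ ps z)          ≡⟨ rearr₂ A (4 ^ suc M) (T₂ ps z) ⟩
    4 ^ suc M * (A * T₂ ps z)          ≤⟨ *-monoʳ-≤ (4 ^ suc M) (sieve-bound d (2 ^ s) (suc x) z
                                            (*-mono-≤ (m^n>0 2 s) (m^n>0 2 s))) ⟩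
    4 ^ suc M * (Φ₂ ps * R)            ≡⟨ rearr₂ (4 ^ suc M) (Φ₂ ps) R ⟩
    Φ₂ ps * (4 ^ suc M * R)            ∎)

-- Prime pairs in residue classes

-- Peel off a 0 and use a² ≤ a on the diagonal. E may exceed J - 1, so that it stays fixed while J
-- decreases.
square-pairs : ∀ J E a → (∀ i → a i ≤ 1) → J ≤ suc E →
  ∑ J a * ∑ J a ≤ ∑ J a + 2 * ∑ E (λ e → ∑ J (λ j → a j * a (j + suc e)))
square-pairs zero E a a≤1 J≤ = ≤-trans (≤-reflexive (cong (_* ∑ 0 a) (∑-zero 0 {a} λ _ ()))) z≤n
square-pairs (suc J) E a a≤1 (s≤s J≤E) = begin
  ∑ (suc J) a * ∑ (suc J) a
    ≡⟨ cong (λ e → e * e) (∑-suc J a) ⟩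
  (a 0 + S) * (a 0 + S)
    ≡⟨ rearr₁ (a 0) S ⟩
  a 0 * a 0 + 2 * (a 0 * S) + S * S
    ≤⟨ +-mono-≤ (+-mono-≤ (≤-trans (*-monoʳ-≤ (a 0) (a≤1 0)) (≤-reflexive (*-identityʳ (a 0))))
                           (*-monoʳ-≤ 2 (*-monoʳ-≤ (a 0) (∑-prefix (a ∘ suc) J≤E))))
                (square-pairs J E (a ∘ suc) (a≤1 ∘ suc) (m≤n⇒m≤1+n J≤E)) ⟩
  a 0 + 2 * (a 0 * ∑ E (a ∘ suc)) + (S + 2 * X)
    ≡⟨ rearr₂ (a 0) (a 0 * ∑ E (a ∘ suc)) S X ⟩
  (a 0 + S) + 2 * (a 0 * ∑ E (a ∘ suc) + X)
    ≡⟨ cong₂ (λ u v → u + 2 * v) (∑-suc J a) regroup ⟨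
  ∑ (suc J) a + 2 * ∑ E (λ e → ∑ (suc J) (λ j → a j * a (j + suc e))) ∎
  where
  S = ∑ J (a ∘ suc)
  X = ∑ E (λ e → ∑ J (λ j → a (suc j) * a (suc j + suc e)))
  regroup : ∑ E (λ e → ∑ (suc J) (λ j → a j * a (j + suc e))) ≡ a 0 * ∑ E (a ∘ suc) + X
  regroup = trans (∑-cong E λ e → ∑-suc J _) (trans (∑-+ E _ _) (cong (_+ X) (∑-*ˡ E (a 0) (a ∘ suc))))
  rearr₁ : ∀ a s → (a + s) * (a + s) ≡ a * a + 2 * (a * s) + s * s
  rearr₁ = solve-∀
  rearr₂ : ∀ a b s x → a + 2 * b + (s + 2 * x) ≡ (a + s) + 2 * (b + x)
  rearr₂ = solve-∀

2ab≤a²+b² : ∀ a b → 2 * (a * b) ≤ a * a + b * b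
2ab≤a²+b² a b = [ ordered a b , (λ b≤a → ≤-trans (≤-reflexive (cong (2 *_) (*-comm a b)))
  (≤-trans (ordered b a b≤a) (≤-reflexive (+-comm (b * b) (a * a))))) ]′ (≤-total a b)
  where
  ordered : ∀ a b → a ≤ b → 2 * (a * b) ≤ a * a + b * b
  ordered a b a≤b with k , refl ← m≤n⇒∃[o]m+o≡n a≤b = ≤-trans (m≤m+n _ (k * k)) (≤-reflexive (eq a k))
    where
    eq : ∀ a k → 2 * (a * (a + k)) + k * k ≡ a * a + (a + k) * (a + k)
    eq = solve-∀

-- Cauchy-Schwarz on the support of `f`: with R the sum of `c` and S that of `f`, sum 2(R·f)S ≤
-- (R·f)² + S² over the points where c = 1.
cauchy-support : ∀ P (f c : ℕ → ℕ) → (∀ r → c r ≡ 1 ⊎ f r ≡ 0) → 1 ≤ ∑ P c →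
  ∑ P f * ∑ P f ≤ ∑ P c * ∑ P (λ r → f r * f r)
cauchy-support P f c supp R>0 = *-cancelˡ-≤ R {{>-nonZero R>0}} (+-cancelˡ-≤ (R * (S * S)) _ _ (begin
  R * (S * S) + R * (S * S)
    ≡⟨ rearr₁ R S ⟩
  2 * (R * S) * S
    ≡⟨ ∑-*ˡ P (2 * (R * S)) f ⟨
  ∑ P (λ r → 2 * (R * S) * f r)
    ≤⟨ ∑-mono P pointwise ⟩
  ∑ P (λ r → R * R * (f r * f r) + S * S * c r)
    ≡⟨ trans (∑-+ P _ _) (cong₂ _+_ (∑-*ˡ P (R * R) _) (∑-*ˡ P (S * S) c)) ⟩
  R * R * Q + S * S * R
    ≡⟨ rearr₂ R S Q ⟩
  R * (S * S) + R * (R * Q) ∎))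
  where
  S = ∑ P f
  R = ∑ P c
  Q = ∑ P (λ r → f r * f r)
  rearr₁ : ∀ r s → r * (s * s) + r * (s * s) ≡ 2 * (r * s) * s
  rearr₁ = solve-∀
  rearr₂ : ∀ r s q → r * r * q + s * s * r ≡ r * (s * s) + r * (r * q)
  rearr₂ = solve-∀
  rearr₃ : ∀ r s f → 2 * (r * s) * f ≡ 2 * ((r * f) * s)
  rearr₃ = solve-∀
  rearr₄ : ∀ r s f → r * f * (r * f) + s * s ≡ r * r * (f * f) + s * s * 1
  rearr₄ = solve-∀
  pointwise : ∀ r → 2 * (R * S) * f r ≤ R * R * (f r * f r) + S * S * c r
  pointwise r with supp r
  ... | inj₂ f≡0 rewrite f≡0 = ≤-trans (≤-reflexive (*-zeroʳ (2 * (R * S)))) z≤n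
  ... | inj₁ c≡1 rewrite c≡1 = begin
    2 * (R * S) * f r                ≡⟨ rearr₃ R S (f r) ⟩
    2 * ((R * f r) * S)              ≤⟨ 2ab≤a²+b² (R * f r) S ⟩
    R * f r * (R * f r) + S * S      ≡⟨ rearr₄ R S (f r) ⟩
    R * R * (f r * f r) + S * S * 1  ∎

largePrime? : ∀ n x m → Dec (Prime m × (m ≤ x × n < m))
largePrime? n x m = prime? m ×-dec (m ≤? x ×-dec n <? m)

π> : ℕ → ℕ → ℕ
π> n x = ∑ (suc x) (λ m → ⟦ largePrime? n x m ⟧)

pairs-lower : ∀ x t g → (∀ e → 0 < e → G x e ≤ g) →
  t * (π> (2 ^ t) x * π> (2 ^ t) x) ≤ 2 * product (primes≤ (2 ^ t)) * π> (2 ^ t) x + 4 * x * g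
pairs-lower x t g G≤g = begin
  t * (Π * Π)
    ≤⟨ *-monoʳ-≤ t (≤-trans cauchy (*-monoʳ-≤ R squares)) ⟩
  t * (R * (Π + 2 * (E * g)))
    ≡⟨ *-assoc t R _ ⟨
  t * R * (Π + 2 * (E * g))
    -- t·φ(P) ≤ 2P removes φ(P), the number of classes.
    ≤⟨ *-monoˡ-≤ _ (≤-trans (T₁-lower t) (*-monoʳ-≤ 2 (T₁≤product (2 ^ t) (All.map <⇒≤ (primes≤-2≤ n))))) ⟩
  2 * P * (Π + 2 * (E * g))
    ≡⟨ rearr P Π E g ⟩
  2 * P * Π + 4 * (E * P) * g
    ≤⟨ +-monoʳ-≤ (2 * P * Π) (*-monoˡ-≤ g (*-monoʳ-≤ 4 (m/n*n≤m x P))) ⟩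
  2 * P * Π + 4 * x * g ∎
  where
  n = 2 ^ t
  ps = primes≤ n
  P = product ps
  R = Φ₁ ps
  all-prime : All Prime ps
  all-prime = all-filter prime? (downFrom (suc n))
  instance
    P≢0 : NonZero P
    P≢0 = productOfPrimes≢0 all-prime
  -- E counts the positive multiples of P up to x, the possible differences; J = E + 1 blocks of
  -- length P cover 0, ..., x.
  E = x / P
  J = suc E
  χ : ℕ → ℕ
  χ m = ⟦ largePrime? n x m ⟧
  χ≤1 : ∀ m → χ m ≤ 1
  χ≤1 m = ⟦⟧≤1 (largePrime? n x m)
  χ-beyond : ∀ m → suc x ≤ m → χ m ≡ 0
  χ-beyond m x<m = ⟦⟧-no (largePrime? n x m) λ (_ , m≤x , _) → <⇒≱ x<m m≤x
  χ-multiple : ∀ {q} m → q ∈ ps → q ∣ m → χ m ≡ 0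
  χ-multiple m q∈ q∣m = ⟦⟧-no (largePrime? n x m) λ (prime-m , _ , n<m) →
    let q∈down , prime-q = ∈-filter⁻ prime? q∈ in
    <⇒≢ (<-≤-trans (∈-downFrom⁻ q∈down) n<m) (prime∣prime⇒≡ prime-q prime-m q∣m)
  Π = π> n x
  f : ℕ → ℕ
  f r = ∑ J (λ j → χ (r + j * P))
  rearr : ∀ P Π E g → 2 * P * (Π + 2 * (E * g)) ≡ 2 * P * Π + 4 * (E * P) * g
  rearr = solve-∀
  reblock : ∀ h → ∑ P (λ r → ∑ J (λ j → h (r + j * P))) ≡ ∑ (J * P) h
  reblock h = trans (∑-swap P J _) (sym (∑-blocks J P h))
  x<JP : suc x ≤ J * P
  x<JP = begin-strict
    x              ≡⟨ m≡m%n+[m/n]*n x P ⟩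
    x % P + E * P  <⟨ +-monoˡ-< (E * P) (m%n<n x P) ⟩
    P + E * P      ∎
  total : ∑ P f ≡ Π
  total = trans (reblock χ) (≤-antisym (∑-trim (suc x) (J * P) χ-beyond) (∑-prefix χ x<JP))
  supp : ∀ r → sift ps r ≡ 1 ⊎ f r ≡ 0
  supp r with any? (_∣? r) ps
  ... | no none = inj₁ (sift-one (¬Any⇒All¬ ps none))
  ... | yes some with q , q∈ , q∣r ← find some = inj₂ (∑-zero J λ j _ →
    χ-multiple (r + j * P) q∈ (∣m∣n⇒∣m+n q∣r (∣n⇒∣m*n j (∈⇒∣product q∈))))
    where
    ∈⇒∣product : ∀ {q ps} → q ∈ ps → q ∣ product ps
    ∈⇒∣product (here refl) = m∣m*n _
    ∈⇒∣product (there {p} q∈) = ∣n⇒∣m*n p (∈⇒∣product q∈)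
  ∑sift : ∑ P (sift ps) ≡ R
  ∑sift = ∑-sift (Unique.filter⁺ prime? (Unique.downFrom⁺ (suc n))) all-prime
  R>0 : 1 ≤ R
  R>0 = prod-pos (_∸ 1) (All.map (λ 2≤p → m<n⇒0<n∸m 2≤p) (primes≤-2≤ n))
  cauchy : Π * Π ≤ R * ∑ P (λ r → f r * f r)
  cauchy = subst₂ (λ u v → u * u ≤ v * ∑ P (λ r → f r * f r)) total ∑sift
    (cauchy-support P f (sift ps) supp (subst (1 ≤_) (sym ∑sift) R>0))
  correlation : ∀ e → ∑ P (λ r → ∑ J (λ j → χ (r + j * P) * χ (r + (j + suc e) * P))) ≤ g
  correlation e = begin
    ∑ P (λ r → ∑ J (λ j → χ (r + j * P) * χ (r + (j + suc e) * P)))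
      ≡⟨ ∑-cong P (λ r → ∑-cong J λ j → cong (λ m → χ (r + j * P) * χ m) (shift r j (suc e) P)) ⟩
    ∑ P (λ r → ∑ J (λ j → χ (r + j * P) * χ (r + j * P + D)))
      ≡⟨ reblock (λ m → χ m * χ (m + D)) ⟩
    ∑ (J * P) (λ m → χ m * χ (m + D))
      ≤⟨ ∑-trim (suc x) (J * P) (λ m x<m → cong (_* χ (m + D)) (χ-beyond m x<m)) ⟩
    ∑ (suc x) (λ m → χ m * χ (m + D))
      ≤⟨ ∑-mono (suc x) (λ m → pointwise m (largePrime? n x m) (largePrime? n x (m + D))) ⟩
    ∑ (suc x) (λ m → ⟦ Q? m ⟧)
      ≡⟨ length-filter-applyUpTo Q? id (suc x) ⟨
    G x D
      ≤⟨ G≤g D (≤-trans (>-nonZero⁻¹ P) (m≤m+n P (e * P))) ⟩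
    g ∎
    where
    D = suc e * P
    Q? : ∀ p → Dec (Prime p × (Prime (p + D) × p + D ≤ x))
    Q? p = prime? p ×-dec (prime? (p + D) ×-dec (p + D ≤? x))
    shift : ∀ r j e P → r + (j + e) * P ≡ r + j * P + e * P
    shift = solve-∀
    pointwise : ∀ m (u : Dec (Prime m × (m ≤ x × n < m))) (v : Dec (Prime (m + D) × (m + D ≤ x × n < m + D))) →
      ⟦ u ⟧ * ⟦ v ⟧ ≤ ⟦ Q? m ⟧
    pointwise m (no _)  _       = z≤n
    pointwise m (yes _) (no _)  = z≤n
    pointwise m (yes (prime-m , _)) (yes (prime-m+D , m+D≤x , _)) =
      ≤-reflexive (sym (⟦⟧-yes (Q? m) (prime-m , prime-m+D , m+D≤x)))
  squares : ∑ P (λ r → f r * f r) ≤ Π + 2 * (E * g)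
  squares = begin
    ∑ P (λ r → f r * f r)
      ≤⟨ ∑-mono P (λ r → square-pairs J E (λ j → χ (r + j * P)) (λ j → χ≤1 (r + j * P)) ≤-refl) ⟩
    ∑ P (λ r → f r + 2 * ∑ E (λ e → ∑ J (λ j → χ (r + j * P) * χ (r + (j + suc e) * P))))
      ≡⟨ trans (∑-+ P _ _) (cong₂ _+_ total (trans (∑-*ˡ P 2 _) (cong (2 *_) (∑-swap P E _)))) ⟩
    Π + 2 * ∑ E (λ e → ∑ P (λ r → ∑ J (λ j → χ (r + j * P) * χ (r + (j + suc e) * P))))
      ≤⟨ +-monoʳ-≤ Π (*-monoʳ-≤ 2 (∑-mono E correlation)) ⟩
    Π + 2 * ∑ E (λ _ → g)
      ≡⟨ cong (λ v → Π + 2 * v) (∑-const E g) ⟩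
    Π + 2 * (E * g) ∎

-- Chebyshev's lower bound

π : ℕ → ℕ
π x = ∑ (suc x) (λ m → ⟦ prime? m ⟧)

^-bracket : ∀ p x → 2 ≤ p → 1 ≤ x → ∃[ e ] (p ^ e ≤ x × x < p ^ suc e)
^-bracket p (suc zero) 2≤p _ = 0 , ≤-refl , ≤-trans 2≤p (≤-reflexive (sym (*-identityʳ p)))
^-bracket p (suc x@(suc _)) 2≤p _ with e , p^e≤x , x<p^ ← ^-bracket p x 2≤p (s≤s z≤n) with p ^ suc e ≤? suc x
... | no  p^≰ = e , m≤n⇒m≤1+n p^e≤x , ≰⇒> p^≰
... | yes p^≤ = suc e , p^≤ , ≤-<-trans x<p^ (^-monoʳ-< p 2≤p (n<1+n (suc e)))

^-∣-^ : ∀ p {a e} → a ≤ e → p ^ a ∣ p ^ e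
^-∣-^ p {a} a≤e with k , refl ← m≤n⇒∃[o]m+o≡n a≤e = subst (p ^ a ∣_) (sym (^-distribˡ-+-* p a k)) (m∣m*n (p ^ k))

prime∣^⇒≡ : ∀ {p q} a → Prime p → Prime q → p ∣ q ^ a → p ≡ q
prime∣^⇒≡ zero    prime-p prime-q p∣1 = contradiction (∣⇒≤ p∣1) (<⇒≱ (prime⇒2≤ prime-p))
prime∣^⇒≡ {q = q} (suc a) prime-p prime-q p∣q^ with euclidsLemma q (q ^ a) prime-p p∣q^
... | inj₁ p∣q  = prime∣prime⇒≡ prime-p prime-q p∣q
... | inj₂ p∣q^ = prime∣^⇒≡ a prime-p prime-q p∣q^

-- Induction along the factorisation of j, cancelling p from j and from L. For powers of p one
-- exponent is cancelled; powers of another prime pass to the quotient by coprimality.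
∣-by-prime-powers : ∀ j .{{_ : NonZero j}} L → (∀ p a → Prime p → p ^ a ∣ j → p ^ a ∣ L) → j ∣ L
∣-by-prime-powers j L powers = subst (_∣ L) (sym isFactorisation)
  (go factors factorsPrime L λ p a prime-p p^a∣ → powers p a prime-p (subst (p ^ a ∣_) (sym isFactorisation) p^a∣))
  where
  open PrimeFactorisation (factorise j)
  go : ∀ fs → All Prime fs → ∀ L → (∀ p a → Prime p → p ^ a ∣ product fs → p ^ a ∣ L) → product fs ∣ L
  go []       []                 L powers = 1∣ L
  go (p ∷ fs) (prime-p ∷ primes) L powers
    with divides L′ refl ← subst (_∣ L) (*-identityʳ p) (powers p 1 prime-p (*-monoʳ-∣ p (1∣ product fs))) =
    subst (_∣ L′ * p) (*-comm (product fs) p) (*-monoˡ-∣ p (go fs primes L′ reduced))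
    where
    instance
      p≢0 : NonZero p
      p≢0 = prime⇒nonZero prime-p
    reduced : ∀ q a → Prime q → q ^ a ∣ product fs → q ^ a ∣ L′
    reduced q a prime-q q^a∣ with q ≟ p
    ... | yes refl = *-cancelʳ-∣ p (subst (_∣ L′ * p) (*-comm p (p ^ a)) (powers p (suc a) prime-p (*-monoʳ-∣ p q^a∣)))
    ... | no q≢p = coprime-divisor
      (coprime-sym (prime∤⇒coprime prime-p λ p∣q^a → q≢p (sym (prime∣^⇒≡ a prime-p prime-q p∣q^a))))
      (subst (q ^ a ∣_) (*-comm L′ p) (powers q a prime-q (∣n⇒∣m*n p q^a∣)))

-- L is the product of the largest powers p^e ≤ x over the primes p < b. Each factor is at most x,
-- so the exponent of x is the number of primes.
prime-powers-multiple : ∀ x → 1 ≤ x → ∀ b → ∃[ L ] (1 ≤ L × L ≤ x ^ ∑ b (λ m → ⟦ prime? m ⟧) ×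
  (∀ p a → Prime p → p < b → p ^ a ≤ x → p ^ a ∣ L))
prime-powers-multiple x 1≤x zero = 1 , ≤-refl , m^n>0 x {{>-nonZero 1≤x}} (∑ 0 (λ m → ⟦ prime? m ⟧)) , λ _ _ _ ()
prime-powers-multiple x 1≤x (suc b) with L , 1≤L , L≤ , powers ← prime-powers-multiple x 1≤x b | prime? b
... | no ¬prime-b = L , 1≤L , ≤-trans L≤ (≤-reflexive (cong (x ^_) (sym ∑≡))) , λ p a prime-p p<sb → powers p a prime-p
    (≤∧≢⇒< (s≤s⁻¹ p<sb) λ { refl → ¬prime-b prime-p })
  where
  ∑≡ : ∑ (suc b) (λ m → ⟦ prime? m ⟧) ≡ ∑ b (λ m → ⟦ prime? m ⟧)
  ∑≡ = trans (∑-last b _) (trans (cong (∑ b (λ m → ⟦ prime? m ⟧) +_) (⟦⟧-no (prime? b) ¬prime-b)) (+-identityʳ _))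
... | yes prime-b with e , b^e≤x , x<b^ ← ^-bracket b x (prime⇒2≤ prime-b) 1≤x =
  b ^ e * L , *-mono-≤ (m^n>0 b {{prime⇒nonZero prime-b}} e) 1≤L ,
  ≤-trans (*-mono-≤ b^e≤x L≤) (≤-reflexive (cong (x ^_) (sym ∑≡))) , powers′
  where
  ∑≡ : ∑ (suc b) (λ m → ⟦ prime? m ⟧) ≡ suc (∑ b (λ m → ⟦ prime? m ⟧))
  ∑≡ = trans (∑-last b _) (trans (cong (∑ b (λ m → ⟦ prime? m ⟧) +_) (⟦⟧-yes (prime? b) prime-b)) (+-comm _ 1))
  powers′ : ∀ p a → Prime p → p < suc b → p ^ a ≤ x → p ^ a ∣ b ^ e * L
  powers′ p a prime-p p<sb p^a≤x with p ≟ b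
  ... | no p≢b = ∣n⇒∣m*n (b ^ e) (powers p a prime-p (≤∧≢⇒< (s≤s⁻¹ p<sb) p≢b) p^a≤x)
  ... | yes refl with a ≤? e
  ...   | yes a≤e = ∣m⇒∣m*n L (^-∣-^ p a≤e)
  ...   | no a≰e = contradiction (≤-trans (^-monoʳ-≤ p {{prime⇒nonZero prime-p}} (≰⇒> a≰e)) p^a≤x) (<⇒≱ x<b^)

common-multiple : ∀ x → 1 ≤ x → ∃[ L ] (1 ≤ L × L ≤ x ^ π x × (∀ j → 1 ≤ j → j ≤ x → j ∣ L))
common-multiple x 1≤x with L , 1≤L , L≤ , powers ← prime-powers-multiple x 1≤x (suc x) =
  L , 1≤L , L≤ , λ j 1≤j j≤x → ∣-by-prime-powers j {{>-nonZero 1≤j}} L λ p a prime-p p^a∣j →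
  power p a prime-p (≤-trans (∣⇒≤ {{>-nonZero 1≤j}} p^a∣j) j≤x) L powers
  where
  power : ∀ p a → Prime p → p ^ a ≤ x → ∀ L → (∀ p a → Prime p → p < suc x → p ^ a ≤ x → p ^ a ∣ L) → p ^ a ∣ L
  power p zero    prime-p p^a≤x L powers = 1∣ L
  power p (suc a) prime-p p^a≤x L powers = powers p (suc a) prime-p
    (s≤s (≤-trans (m≤m*n p (p ^ a) {{m^n≢0 p a {{prime⇒nonZero prime-p}}}}) p^a≤x)) p^a≤x

-- binom k l is the binomial coefficient C(k + l, k).
binom : ℕ → ℕ → ℕ
binom zero    l       = 1
binom (suc k) zero    = 1
binom (suc k) (suc l) = binom k (suc l) + binom (suc k) l

-- Proved together with `binom-absorbʳ`: after Pascal's rule each identity calls on the other at a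
-- smaller index.
binom-absorbˡ : ∀ k l → suc k * binom (suc k) l ≡ suc (k + l) * binom k l
binom-absorbʳ : ∀ k l → suc l * binom k (suc l) ≡ suc (k + l) * binom k l

binom-absorbˡ zero    zero    = refl
binom-absorbˡ zero    (suc l) = trans (step (binom 1 l)) (trans (cong suc (binom-absorbˡ zero l)) refl)
  where
  step : ∀ a → 1 * (1 + a) ≡ suc (1 * a)
  step = solve-∀
binom-absorbˡ (suc k) zero    rewrite +-identityʳ k = refl
binom-absorbˡ (suc k) (suc l) = begin-equality
  suc (suc k) * (b + binom (suc (suc k)) l)                ≡⟨ *-distribˡ-+ (suc (suc k)) b _ ⟩
  suc (suc k) * b + suc (suc k) * binom (suc (suc k)) l    ≡⟨ cong (suc (suc k) * b +_) (binom-absorbˡ (suc k) l) ⟩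
  suc (suc k) * b + suc (suc k + l) * binom (suc k) l      ≡⟨ cong (suc (suc k) * b +_) (binom-absorbʳ (suc k) l) ⟨
  suc (suc k) * b + suc l * b                              ≡⟨ rearr k l b ⟩
  suc (suc k + suc l) * b                                  ∎
  where
  b = binom (suc k) (suc l)
  rearr : ∀ k l b → suc (suc k) * b + suc l * b ≡ suc (suc k + suc l) * b
  rearr = solve-∀

binom-absorbʳ zero    l       = refl
binom-absorbʳ (suc k) zero    = begin-equality
  1 * (binom k 1 + 1)              ≡⟨ rearr (binom k 1) ⟩
  1 * binom k 1 + 1                ≡⟨ cong (_+ 1) (binom-absorbʳ k zero) ⟩
  suc (k + 0) * binom k 0 + 1      ≡⟨ cong (λ b → suc (k + 0) * b + 1) (binom-zero k) ⟩
  suc (k + 0) * 1 + 1              ≡⟨ rearr′ k ⟩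
  suc (suc k + 0) * 1              ∎
  where
  rearr : ∀ a → 1 * (a + 1) ≡ 1 * a + 1
  rearr = solve-∀
  rearr′ : ∀ k → suc (k + 0) * 1 + 1 ≡ suc (suc k + 0) * 1
  rearr′ = solve-∀
  binom-zero : ∀ k → binom k 0 ≡ 1
  binom-zero zero    = refl
  binom-zero (suc k) = refl
binom-absorbʳ (suc k) (suc l) = begin-equality
  suc (suc l) * (binom k (suc (suc l)) + b)                ≡⟨ *-distribˡ-+ (suc (suc l)) (binom k (suc (suc l))) b ⟩
  suc (suc l) * binom k (suc (suc l)) + suc (suc l) * b    ≡⟨ cong (_+ suc (suc l) * b) (binom-absorbʳ k (suc l)) ⟩
  suc (k + suc l) * binom k (suc l) + suc (suc l) * b      ≡⟨ cong (_+ suc (suc l) * b) (binom-absorbˡ k (suc l)) ⟨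
  suc k * b + suc (suc l) * b                              ≡⟨ rearr k l b ⟩
  suc (suc k + suc l) * b                                  ∎
  where
  b = binom (suc k) (suc l)
  rearr : ∀ k l b → suc k * b + suc (suc l) * b ≡ suc (suc k + suc l) * b
  rearr = solve-∀

binom>0 : ∀ k l → 1 ≤ binom k l
binom>0 zero    l       = ≤-refl
binom>0 (suc k) zero    = ≤-refl
binom>0 (suc k) (suc l) = ≤-trans (binom>0 k (suc l)) (m≤m+n _ _)

2^≤binom : ∀ j → 2 ^ j ≤ binom j j
2^≤binom zero    = ≤-refl
2^≤binom (suc j) = begin
  2 * 2 ^ j                            ≡⟨ cong (2 ^ j +_) (+-identityʳ (2 ^ j)) ⟩
  2 ^ j + 2 ^ j                        ≤⟨ +-mono-≤ (≤-trans (2^≤binom j) (incʳ j j)) (≤-trans (2^≤binom j) (incˡ j j)) ⟩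
  binom j (suc j) + binom (suc j) j    ∎
  where
  incʳ : ∀ k l → binom k l ≤ binom k (suc l)
  incʳ zero    l = ≤-refl
  incʳ (suc k) l = m≤n+m (binom (suc k) l) (binom k (suc l))
  incˡ : ∀ k l → binom k l ≤ binom (suc k) l
  incˡ zero    zero    = ≤-refl
  incˡ (suc k) zero    = ≤-refl
  incˡ k       (suc l) = m≤m+n (binom k (suc l)) (binom (suc k) l)

-- The reciprocals 1/((n+1) C(n,k)) form Leibniz's harmonic triangle: each is the sum of
-- the two below it, so a common multiple of 1, …, n+1 clears all denominators.
leibniz : ∀ D k l → (∀ j → 1 ≤ j → j ≤ suc (k + l) → j ∣ D) → suc (k + l) * binom k l ∣ D
leibniz D zero    l multiple = subst (_∣ D) (sym (*-identityʳ (suc l))) (multiple (suc l) (s≤s z≤n) ≤-refl)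
leibniz D (suc k) l multiple
  with divides u eq-u ← leibniz D k l (λ j 1≤j j≤ → multiple j 1≤j (m≤n⇒m≤1+n j≤))
     | divides v eq-v ← leibniz D k (suc l) (λ j 1≤j j≤ → multiple j 1≤j (≤-trans j≤ (≤-reflexive (cong suc (+-suc k l))))) =
  -- Let a′ be the denominator at k, l + 1. From 1/c = 1/a - 1/a′ the quotient D/c is D/a - D/a′ = u
  -- - v.
  divides (u ∸ v) (*-cancelˡ-≡ D ((u ∸ v) * c) (suc k) (begin-equality
    suc k * D                        ≡⟨ cong (suc k *_) eq-u ⟩
    suc k * (u * a)                  ≡⟨ *-assoc (suc k) u a ⟨
    suc k * u * a                    ≡⟨ cong (_* a) key′ ⟩
    (u ∸ v) * n * a                  ≡⟨ *-assoc (u ∸ v) n a ⟩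
    (u ∸ v) * (n * a)                ≡⟨ cong ((u ∸ v) *_) c-eq ⟨
    (u ∸ v) * (suc k * c)            ≡⟨ swap (u ∸ v) (suc k) c ⟩
    suc k * ((u ∸ v) * c)            ∎))
  where
  n = suc (suc k + l)
  a = suc (k + l) * binom k l
  c = n * binom (suc k) l
  swap : ∀ x y z → x * (y * z) ≡ y * (x * z)
  swap = solve-∀
  c-eq : suc k * c ≡ n * a
  c-eq = trans (swap (suc k) n (binom (suc k) l)) (cong (n *_) (binom-absorbˡ k l))
  instance
    a≢0 : NonZero a
    a≢0 = >-nonZero (*-mono-≤ {1} {suc (k + l)} (s≤s z≤n) (binom>0 k l))
  key : u * suc l ≡ v * n
  key = *-cancelʳ-≡ (u * suc l) (v * n) a (begin-equality
    u * suc l * a                                     ≡⟨ rearr₁ u (suc l) a ⟩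
    suc l * (u * a)                                   ≡⟨ cong (suc l *_) (trans (sym eq-u) eq-v) ⟩
    suc l * (v * (suc (k + suc l) * binom k (suc l))) ≡⟨ rearr₂ (suc l) v (suc (k + suc l)) (binom k (suc l)) ⟩
    v * suc (k + suc l) * (suc l * binom k (suc l))   ≡⟨ cong₂ (λ m b → v * m * b) (cong suc (+-suc k l)) (binom-absorbʳ k l) ⟩
    v * n * a                                         ∎)
    where
    rearr₁ : ∀ u l a → u * l * a ≡ l * (u * a)
    rearr₁ = solve-∀
    rearr₂ : ∀ l v m b → l * (v * (m * b)) ≡ v * m * (l * b)
    rearr₂ = solve-∀
  key′ : suc k * u ≡ (u ∸ v) * n
  key′ = begin-equality
    suc k * u                     ≡⟨ m+n∸n≡m (suc k * u) (u * suc l) ⟨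
    suc k * u + u * suc l ∸ u * suc l ≡⟨ cong₂ _∸_ (rearr k l u) key ⟩
    u * n ∸ v * n                 ≡⟨ *-distribʳ-∸ n u v ⟨
    (u ∸ v) * n                   ∎
    where
    rearr : ∀ k l u → suc k * u + u * suc l ≡ u * suc (suc k + l)
    rearr = solve-∀

-- A common multiple L of 1, ..., x is caught between 2^j, through the central binomial coefficient
-- dividing it, and x^π(x), through its prime powers.
chebyshev : ∀ x j m → suc (j + j) ≤ x → x ≤ 2 ^ m → j ≤ m * π x
chebyshev x j m 2j<x x≤2^m with L , 1≤L , L≤ , multiple ← common-multiple x (≤-trans (s≤s z≤n) 2j<x) =
  ≮⇒≥ λ mπ<j → <⇒≱ (^-monoʳ-< 2 (s≤s (s≤s z≤n)) mπ<j) (begin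
    2 ^ j                        ≤⟨ 2^≤binom j ⟩
    binom j j                    ≤⟨ m≤n*m (binom j j) (suc (j + j)) ⟩
    suc (j + j) * binom j j      ≤⟨ ∣⇒≤ {{>-nonZero 1≤L}} (leibniz L j j λ i 1≤i i≤ → multiple i 1≤i (≤-trans i≤ 2j<x)) ⟩
    L                            ≤⟨ L≤ ⟩
    x ^ π x                      ≤⟨ ^-monoˡ-≤ (π x) x≤2^m ⟩
    (2 ^ m) ^ π x                ≡⟨ ^-*-assoc 2 m (π x) ⟩
    2 ^ (m * π x)                ∎)

π≤π> : ∀ n x → π x ≤ π> n x + suc n
π≤π> n x = begin
  ∑ (suc x) (λ m → ⟦ prime? m ⟧)
    ≤⟨ ∑-mono< (suc x) (λ m m<sx → pointwise m (s≤s⁻¹ m<sx) (prime? m) (m ≤? n)) ⟩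
  ∑ (suc x) (λ m → ⟦ largePrime? n x m ⟧ + ⟦ m ≤? n ⟧)
    ≡⟨ ∑-+ (suc x) _ _ ⟩
  π> n x + ∑ (suc x) (λ m → ⟦ m ≤? n ⟧)
    ≤⟨ +-monoʳ-≤ (π> n x) (∑≤? (suc x) n) ⟩
  π> n x + suc n ∎
  where
  pointwise : ∀ m → m ≤ x → (u : Dec (Prime m)) (v : Dec (m ≤ n)) → ⟦ u ⟧ ≤ ⟦ largePrime? n x m ⟧ + ⟦ v ⟧
  pointwise m m≤x (no _)        _         = z≤n
  pointwise m m≤x (yes _)       (yes _)   = m≤n+m 1 _
  pointwise m m≤x (yes prime-m) (no m≰n)  =
    ≤-trans (≤-reflexive (sym (⟦⟧-yes (largePrime? n x m) (prime-m , m≤x , ≰⇒> m≰n)))) (m≤m+n _ 0)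

-- Comparison of the bounds

n<2^n : ∀ n → n < 2 ^ n
n<2^n zero    = ≤-refl
n<2^n (suc n) = begin-strict
  suc n            ≤⟨ n<2^n n ⟩
  2 ^ n            <⟨ ^-monoʳ-< 2 (s≤s (s≤s z≤n)) (n<1+n n) ⟩
  2 ^ suc n        ∎

*-≡-^ : ∀ w {a b} i j → a ≡ w ^ i → b ≡ w ^ j → a * b ≡ w ^ (i + j)
*-≡-^ w i j a≡ b≡ = trans (cong₂ _*_ a≡ b≡) (sym (^-distribˡ-+-* w i j))

-- Origin of the exponent 30: with w = 2^s, B ≤ w^10 gives 2B² ≤ w^21, and the primes up to w
-- contribute at most w^4; both are at most w^30 ≤ x.
G-upper′ : ∀ d .{{_ : NonZero d}} M x s → ω d < M → 1 ≤ s → 2 ^ (s * 30) ≤ x → G x d * (s * s) ≤ 4 * 4 ^ suc M * x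
G-upper′ d M x s ω<M 1≤s 2^≤x = begin
  G x d * (s * s)
    ≤⟨ G-upper d M x s ω<M ⟩
  C * (suc x + 2 * (B * B)) + suc w * (s * s)
    ≤⟨ +-mono-≤ (*-monoʳ-≤ C (+-mono-≤ suc-x≤ (≤-trans error≤ (w^≤x 21 (from-yes (21 ≤? 30))))))
                (≤-trans small≤ (w^≤x 4 (from-yes (4 ≤? 30)))) ⟩
  C * (2 * x + x) + x
    ≤⟨ +-monoʳ-≤ (C * (2 * x + x)) (m≤n*m x C {{>-nonZero (m^n>0 4 (suc M))}}) ⟩
  C * (2 * x + x) + C * x
    ≡⟨ rearr C x ⟩
  4 * C * x ∎
  where
  w = 2 ^ s
  z = w * w
  C = 4 ^ suc M
  B = suc (suc w) * (z * z * (z * z))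
  rearr : ∀ c x → c * (2 * x + x) + c * x ≡ 4 * c * x
  rearr = solve-∀
  2≤w : 2 ≤ w
  2≤w = ^-monoʳ-≤ 2 1≤s
  instance
    w≢0 : NonZero w
    w≢0 = m^n≢0 2 s
  w^≤x : ∀ i → i ≤ 30 → w ^ i ≤ x
  w^≤x i i≤30 = begin
    w ^ i         ≤⟨ ^-monoʳ-≤ w i≤30 ⟩
    w ^ 30        ≡⟨ ^-*-assoc 2 s 30 ⟩
    2 ^ (s * 30)  ≤⟨ 2^≤x ⟩
    x             ∎
  w² : w * w ≡ w ^ 2
  w² = cong (w *_) (sym (*-identityʳ w))
  w+w≤w² : w + w ≤ w * w
  w+w≤w² = ≤-trans (≤-reflexive (cong (w +_) (sym (+-identityʳ w)))) (*-monoˡ-≤ w 2≤w)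
  suc-x≤ : suc x ≤ 2 * x
  suc-x≤ = begin
    1 + x  ≤⟨ +-monoˡ-≤ x (w^≤x 0 z≤n) ⟩
    x + x  ≡⟨ cong (x +_) (+-identityʳ x) ⟨
    2 * x  ∎
  B≤ : B ≤ w ^ 10
  B≤ = begin
    suc (suc w) * (z * z * (z * z))
      ≤⟨ *-monoˡ-≤ (z * z * (z * z)) (≤-trans (+-monoˡ-≤ w 2≤w) w+w≤w²) ⟩
    w * w * (z * z * (z * z))
      ≡⟨ *-≡-^ w 2 8 w² (*-≡-^ w 4 4 (*-≡-^ w 2 2 w² w²) (*-≡-^ w 2 2 w² w²)) ⟩
    w ^ 10 ∎
  error≤ : 2 * (B * B) ≤ w ^ 21
  error≤ = *-mono-≤ 2≤w (≤-trans (*-mono-≤ B≤ B≤) (≤-reflexive (sym (^-distribˡ-+-* w 10 10))))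
  small≤ : suc w * (s * s) ≤ w ^ 4
  small≤ = begin
    suc w * (s * s)    ≤⟨ *-mono-≤ (≤-trans (+-monoˡ-≤ w (m^n>0 2 s)) w+w≤w²)
                                   (*-mono-≤ (<⇒≤ (n<2^n s)) (<⇒≤ (n<2^n s))) ⟩
    w * w * (w * w)    ≡⟨ *-≡-^ w 2 2 w² w² ⟩
    w ^ 4              ∎

-- Insert x ≤ c·s·p into t·x². The term with g is of order x² by the upper bound, and the diagonal
-- term is at most x² by the last size condition, so x² cancels and only constants bound t.
t-bound : ∀ c C t P p g s x → 1 ≤ x →
  t * (p * p) ≤ 2 * P * p + 4 * x * g → g * (s * s) ≤ 4 * C * x → x ≤ c * s * p → p ≤ 2 * x → 4 * P * (s * s) ≤ x →
  t ≤ c * c * (1 + 16 * C)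
t-bound c C t P p g s x 1≤x lower upper cheb p≤2x large =
  *-cancelʳ-≤ t (c * c * (1 + 16 * C)) (x * x) {{>-nonZero (*-mono-≤ 1≤x 1≤x)}} (begin
  t * (x * x)
    ≤⟨ *-monoʳ-≤ t (*-mono-≤ cheb cheb) ⟩
  t * (c * s * p * (c * s * p))
    ≡⟨ rearr₁ t c s p ⟩
  c * c * (s * s * (t * (p * p)))
    ≤⟨ *-monoʳ-≤ (c * c) (*-monoʳ-≤ (s * s) lower) ⟩
  c * c * (s * s * (2 * P * p + 4 * x * g))
    ≡⟨ cong (c * c *_) (rearr₂ s P p x g) ⟩
  c * c * (2 * P * (s * s) * p + 4 * x * (g * (s * s)))
    ≤⟨ *-monoʳ-≤ (c * c) (+-mono-≤ (*-monoʳ-≤ (2 * P * (s * s)) p≤2x) (*-monoʳ-≤ (4 * x) upper)) ⟩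
  c * c * (2 * P * (s * s) * (2 * x) + 4 * x * (4 * C * x))
    ≡⟨ cong (c * c *_) (rearr₃ P s x C) ⟩
  c * c * (4 * P * (s * s) * x + 16 * C * (x * x))
    ≤⟨ *-monoʳ-≤ (c * c) (+-monoˡ-≤ (16 * C * (x * x)) (*-monoˡ-≤ x large)) ⟩
  c * c * (x * x + 16 * C * (x * x))
    ≡⟨ rearr₄ (c * c) C (x * x) ⟩
  c * c * (1 + 16 * C) * (x * x) ∎)
  where
  rearr₁ : ∀ t c s p → t * (c * s * p * (c * s * p)) ≡ c * c * (s * s * (t * (p * p)))
  rearr₁ = solve-∀
  rearr₂ : ∀ s P p x g → s * s * (2 * P * p + 4 * x * g) ≡ 2 * P * (s * s) * p + 4 * x * (g * (s * s))
  rearr₂ = solve-∀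
  rearr₃ : ∀ P s x C → 2 * P * (s * s) * (2 * x) + 4 * x * (4 * C * x) ≡ 4 * P * (s * s) * x + 16 * C * (x * x)
  rearr₃ = solve-∀
  rearr₄ : ∀ k C y → k * (y + 16 * C * y) ≡ k * (1 + 16 * C) * y
  rearr₄ = solve-∀

π>≤ : ∀ n x → π> n x ≤ suc x
π>≤ n x = ≤-trans (∑-mono (suc x) λ m → ⟦⟧≤1 (largePrime? n x m)) (≤-reflexive (trans (∑-const (suc x) 1) (*-identityʳ (suc x))))

-- 960 = 2·8·60: x ≤ 8j for j = ⌊x/4⌋, m ≤ 60s, and doubling makes room for the primes up to n.
π-lower : ∀ x s n m → 4 ≤ x → x < 2 ^ m → m ≤ s * 60 → 960 * s * suc n ≤ x → x ≤ 960 * s * π> n x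
π-lower x s n m 4≤x x<2^m m≤ large = +-cancelʳ-≤ x x (960 * s * p) (begin
  x + x
    ≤⟨ +-mono-≤ x≤8·60sπ x≤8·60sπ ⟩
  s * 60 * π x * 8 + s * 60 * π x * 8
    ≡⟨ collect s 60 8 960 (π x) refl ⟩
  960 * s * π x
    ≤⟨ *-monoʳ-≤ (960 * s) (π≤π> n x) ⟩
  960 * s * (p + suc n)
    ≡⟨ *-distribˡ-+ (960 * s) p (suc n) ⟩
  960 * s * p + 960 * s * suc n
    ≤⟨ +-monoʳ-≤ (960 * s * p) large ⟩
  960 * s * p + x ∎)
  where
  p = π> n x
  j = x / 4
  collect : ∀ s k l c y → 2 * (k * l) ≡ c → s * k * y * l + s * k * y * l ≡ c * s * y
  collect s k l .(2 * (k * l)) y refl = identity s k l y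
    where
    identity : ∀ s k l y → s * k * y * l + s * k * y * l ≡ 2 * (k * l) * s * y
    identity = solve-∀
  1≤j : 1 ≤ j
  1≤j = m≥n⇒m/n>0 4≤x
  2j<x : suc (j + j) ≤ x
  2j<x = begin
    1 + (j + j)        ≤⟨ +-monoˡ-≤ (j + j) (≤-trans 1≤j (m≤m+n j j)) ⟩
    (j + j) + (j + j)  ≡⟨ four j ⟩
    j * 4              ≤⟨ m/n*n≤m x 4 ⟩
    x                  ∎
    where
    four : ∀ j → (j + j) + (j + j) ≡ j * 4
    four = solve-∀
  x≤8·60sπ : x ≤ s * 60 * π x * 8
  x≤8·60sπ = begin
    x                 ≡⟨ m≡m%n+[m/n]*n x 4 ⟩
    x % 4 + j * 4     ≤⟨ +-monoˡ-≤ (j * 4) (≤-trans (m%n≤n x 4) (*-monoˡ-≤ 4 1≤j)) ⟩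
    j * 4 + j * 4     ≡⟨ *-distribˡ-+ j 4 4 ⟨
    j * 8             ≤⟨ *-monoˡ-≤ 8 (chebyshev x j (s * 60) 2j<x (≤-trans (<⇒≤ x<2^m) (^-monoʳ-≤ 2 m≤))) ⟩
    s * 60 * π x * 8  ∎

-- For e = ⌊log₂ x⌋, s is ⌊e/30⌋. As s ≥ 1, the remainder is covered by doubling 30s to 60s.
scale : ∀ K x → 1 ≤ K → 2 ^ (K * 30) ≤ x → ∃[ s ] ∃[ m ] (K ≤ s × 2 ^ (s * 30) ≤ x × x < 2 ^ m × m ≤ s * 60)
scale K x 1≤K X≤x with e , 2^e≤x , x<2^ ← ^-bracket 2 x ≤-refl (≤-trans (m^n>0 2 (K * 30)) X≤x) =
  s , suc e , K≤s , ≤-trans (^-monoʳ-≤ 2 (m/n*n≤m e 30)) 2^e≤x , x<2^ , e<s*60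
  where
  s = e / 30
  e< : suc e ≤ suc s * 30
  e< = begin-strict
    e               ≡⟨ m≡m%n+[m/n]*n e 30 ⟩
    e % 30 + s * 30 <⟨ +-monoˡ-< (s * 30) (m%n<n e 30) ⟩
    30 + s * 30     ∎
  K≤s : K ≤ s
  K≤s = ≮⇒≥ λ s<K → <⇒≱ x<2^ (≤-trans (^-monoʳ-≤ 2 (≤-trans e< (*-monoˡ-≤ 30 s<K))) X≤x)
  e<s*60 : suc e ≤ s * 60
  e<s*60 = begin
    suc e            ≤⟨ e< ⟩
    30 + s * 30      ≤⟨ +-monoˡ-≤ (s * 30) (*-monoˡ-≤ 30 (≤-trans 1≤K K≤s)) ⟩
    s * 30 + s * 30  ≡⟨ *-distribˡ-+ s 30 30 ⟨
    s * 60           ∎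

-- In the threshold for s, 960·(2^t + 1) covers the primes up to 2^t lost in `π-lower`, and 4P the
-- diagonal term of `pairs-lower`; x ≥ (2^s)³ supplies the remaining factors s.
few-factors-t-bound : ∀ M t x s m d → 960 * suc (2 ^ t) + 4 * product (primes≤ (2 ^ t)) ≤ s →
  2 ^ (s * 30) ≤ x → x < 2 ^ m → m ≤ s * 60 → Champion x d → ω d < M → t ≤ 960 * 960 * (1 + 16 * 4 ^ suc M)
few-factors-t-bound M t x s m d K≤s 2^≤x x<2^m m≤ (0<d , G≤) ω<M =
  t-bound 960 (4 ^ suc M) t P (π> n x) (G x d) s x (≤-trans (s≤s z≤n) 4≤x)
    (pairs-lower x t (G x d) G≤)
    (G-upper′ d {{>-nonZero 0<d}} M x s ω<M 1≤s 2^≤x)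
    (π-lower x s n m 4≤x x<2^m m≤ large₁)
    (≤-trans (π>≤ n x) (≤-trans (+-monoˡ-≤ x (≤-trans (s≤s z≤n) 4≤x)) (≤-reflexive (cong (x +_) (sym (+-identityʳ x))))))
    large₂
  where
  n = 2 ^ t
  P = product (primes≤ n)
  w = 2 ^ s
  s≤w : s ≤ w
  s≤w = <⇒≤ (n<2^n s)
  1≤s : 1 ≤ s
  1≤s = ≤-trans (≤-trans (s≤s z≤n) (m≤n*m (suc n) 960)) (≤-trans (m≤m+n _ (4 * P)) K≤s)
  w^3≤x : w ^ 3 ≤ x
  w^3≤x = begin
    w ^ 3         ≡⟨ ^-*-assoc 2 s 3 ⟩
    2 ^ (s * 3)   ≤⟨ ^-monoʳ-≤ 2 (*-monoʳ-≤ s (m≤m+n 3 27)) ⟩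
    2 ^ (s * 30)  ≤⟨ 2^≤x ⟩
    x             ∎
  instance
    w≢0 : NonZero w
    w≢0 = m^n≢0 2 s
  4≤x : 4 ≤ x
  4≤x = ≤-trans (m≤m+n 4 4) (≤-trans (^-monoˡ-≤ 3 (^-monoʳ-≤ 2 1≤s)) w^3≤x)
  cube : ∀ w → w * (w * w) ≡ w ^ 3
  cube w = cong (λ v → w * (w * v)) (sym (*-identityʳ w))
  large₁ : 960 * s * suc n ≤ x
  large₁ = begin
    960 * s * suc n    ≡⟨ trans (cong (_* suc n) (*-comm 960 s)) (*-assoc s 960 (suc n)) ⟩
    s * (960 * suc n)  ≤⟨ *-mono-≤ s≤w (≤-trans (m≤m+n _ (4 * P)) (≤-trans K≤s s≤w)) ⟩
    w * w              ≤⟨ *-monoʳ-≤ w (m≤m*n w w) ⟩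
    w * (w * w)        ≡⟨ cube w ⟩
    w ^ 3              ≤⟨ w^3≤x ⟩
    x                  ∎
  large₂ : 4 * P * (s * s) ≤ x
  large₂ = begin
    4 * P * (s * s)  ≤⟨ *-mono-≤ (≤-trans (m≤n+m (4 * P) (960 * suc n)) (≤-trans K≤s s≤w)) (*-mono-≤ s≤w s≤w) ⟩
    w * (w * w)      ≡⟨ cube w ⟩
    w ^ 3            ≤⟨ w^3≤x ⟩
    x                ∎

-- Opaque, because the type checker would otherwise evaluate the thresholds chosen below.
opaque
  ∃-above : ∀ b → ∃[ k ] b < k
  ∃-above b = suc b , ≤-refl

-- Choice of the parameters

few-factors-impossible : ∀ M t K → 960 * 960 * (1 + 16 * 4 ^ suc M) < t →
  960 * suc (2 ^ t) + 4 * product (primes≤ (2 ^ t)) < K →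
  ∀ x → 2 ^ (K * 30) ≤ x → ∀ d → Champion x d → M ≤ ω d
few-factors-impossible M t K b<t k<K x X≤x d champion = ≮⇒≥ λ ω<M →
  let s , m , K≤s , 2^≤x , x<2^m , m≤ = scale K x (≤-trans (s≤s z≤n) k<K) X≤x in
  <⇒≱ b<t (few-factors-t-bound M t x s m d (≤-trans (<⇒≤ k<K) K≤s) 2^≤x x<2^m m≤ champion ω<M)

ω-large : ∀ M → ∃[ X ] (∀ x → X ≤ x → ∀ d → Champion x d → M ≤ ω d)
ω-large M = 2 ^ (proj₁ K * 30) , few-factors-impossible M (proj₁ t) (proj₁ K) (proj₂ t) (proj₂ K)
  where
  t = ∃-above (960 * 960 * (1 + 16 * 4 ^ suc M))
  K = ∃-above (960 * suc (2 ^ proj₁ t) + 4 * product (primes≤ (2 ^ proj₁ t)))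

ω≤ : ∀ d → ω d ≤ suc d
ω≤ d = ≤-trans (length-filter (λ p → prime? p ×-dec (p ∣? d)) (upTo (suc d))) (≤-reflexive (length-upTo (suc d)))

theorem2 : ∀ (M : ℕ) → ∃[ X ] (∀ (x : ℕ) → X ≤ x → ∀ (d : ℕ) → Champion x d → (M ≤ d) × (M ≤ ω d))
theorem2 M = X , λ x X≤x d champion →
  s≤s⁻¹ (≤-trans (M<ω x X≤x d champion) (ω≤ d)) , <⇒≤ (M<ω x X≤x d champion)
  where
  -- One prime factor more than M is requested because `ω≤` bounds ω(d) by d + 1.
  X = proj₁ (ω-large (suc M))
  M<ω = proj₂ (ω-large (suc M))
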